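{- For nonnegative integers $n,m$, \[ \sum_{r=0}^n \sum_{s=0}^m \mathcal{K}_{n,m;r,s}(z/q,w/q;q)\,\Phi_{r,s}(u,v;c,d;z,w;q)=\Phi_{n,m}(uz,vw;cz,dw;z,w;q). \]
   Context: $u,v,c,d,z,w,q$ indeterminates; $(a;q)_\infty=\prod_{j\geq0}(1-aq^j)$, $(a;q)_n=(a;q)_\infty/(aq^n;q)_\infty$ for $n\in\mathbb{Z}$ (so $1/(q;q)_n=0$ for $n<0$). $\mathcal{K}_{n,m;r,s}(z,w;q):=\frac{z^rw^sq^{r^2-rs+s^2}}{(q;q)_{n-r}(q;q)_{m-s}}$. For $y\in\mathbb{Z}^3$ with $y_1+y_2+y_3=0$: $\Phi_{n,m;y}(z,w;q):=\frac{(zwq;q)_{n+m}}{(q;q)_{n-y_1}(zq;q)_{n-y_2}(zwq;q)_{n-y_3}(q;q)_{m+y_3}(wq;q)_{m+y_2}(zwq;q)_{m+y_1}}$. With $\rho=(1,2,3)$ and $\sigma=(\sigma_1,\sigma_2,\sigma_3)$ ranging over permutations of $(1,2,3)$, $\Phi_{n,m}(u,v;c,d;z,w;q):=\sum_{\sigma\in S_3}\operatorname{sgn}(\sigma)(uz)^{\sigma_1-1}(v/d)^{\chi(\sigma_3=1)}(c/u)^{\chi(\sigma_1=3)}(dw)^{3-\sigma_3}\Phi_{n,m;\sigma-\rho}(z/q,w/q;q)$, where $\chi(P)\in\{0,1\}$ is the indicator of $P$. -}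

module Defs where

open import Level using (Level; _⊔_) renaming (suc to lsuc)
open import Algebra.Bundles using (CommutativeRing)
open import Data.Nat as ℕ using (ℕ; zero; suc)
open import Data.Integer as ℤ using (ℤ; +_; -[1+_])
open import Data.List using (List; []; _∷_; foldr; map)
open import Data.Product using (_×_; _,_)
open import Data.Bool using (Bool; true; false; if_then_else_)
open import Relation.Nullary using (¬_)

record Field c ℓ : Set (lsuc (c ⊔ ℓ)) where
  infix 8 _⁻¹
  field
    commutativeRing : CommutativeRing c ℓ
  open CommutativeRing commutativeRing public
  field
    _⁻¹        : Carrier → Carrier
    ⁻¹-inverse : ∀ x → ¬ (x ≈ 0#) → x * (x ⁻¹) ≈ 1#
    0≉1        : ¬ (0# ≈ 1#)

module QCalculus {c ℓ : Level} (F : Field c ℓ) where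
  open Field F hiding (zero)

  pow : Carrier → ℕ → Carrier
  pow x zero    = 1#
  pow x (suc n) = x * pow x n

  zpow : Carrier → ℤ → Carrier
  zpow x (+ n)      = pow x n
  zpow x -[1+ n ]   = pow (x ⁻¹) (suc n)

  prodTo : ℕ → (ℕ → Carrier) → Carrier
  prodTo zero    f = 1#
  prodTo (suc n) f = prodTo n f * f n

  sumUpTo : ℕ → (ℕ → Carrier) → Carrier
  sumUpTo zero    f = f zero
  sumUpTo (suc n) f = sumUpTo n f + f (suc n)

  poch : Carrier → Carrier → ℕ → Carrier
  poch a q n = prodTo n (λ j → 1# - a * pow q j)

  -- 1/(a;q)_n for n ∈ ℤ, following (a;q)_n = (a;q)_∞/(aq^n;q)_∞:
  --   n ≥ 0 :  ((a;q)_n)⁻¹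
  --   n = -N < 0 : (a q^{-N};q)_N = prod_{i=1}^{N} (1 - a q^{-i})
  -- (in particular 1/(q;q)_n = 0 for n < 0, since the i = 1 factor is 1 - q q⁻¹)
  recipPoch : Carrier → Carrier → ℤ → Carrier
  recipPoch a q (+ n)     = (poch a q n) ⁻¹
  recipPoch a q -[1+ k ]  = prodTo (suc k) (λ i → 1# - a * pow (q ⁻¹) (suc i))

  K : ℕ → ℕ → ℕ → ℕ → Carrier → Carrier → Carrier → Carrier
  K n m r s Z W q =
    pow Z r * pow W s
      * zpow q (+ (r ℕ.* r) ℤ.- + (r ℕ.* s) ℤ.+ + (s ℕ.* s))
      * recipPoch q q (+ n ℤ.- + r) * recipPoch q q (+ m ℤ.- + s)

  -- Φ_{n,m;y}(Z,W;q) for y = (y₁,y₂,y₃) ∈ ℤ³ (with y₁+y₂+y₃ = 0 in all uses)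
  PhiY : ℕ → ℕ → ℤ → ℤ → ℤ → Carrier → Carrier → Carrier → Carrier
  PhiY n m y₁ y₂ y₃ Z W q =
    poch (Z * W * q) q (n ℕ.+ m)
      * recipPoch q q (+ n ℤ.- y₁)
      * recipPoch (Z * q) q (+ n ℤ.- y₂)
      * recipPoch (Z * W * q) q (+ n ℤ.- y₃)
      * recipPoch q q (+ m ℤ.+ y₃)
      * recipPoch (W * q) q (+ m ℤ.+ y₂)
      * recipPoch (Z * W * q) q (+ m ℤ.+ y₁)

  χ : Bool → ℕ
  χ true  = 1
  χ false = 0

  S₃ : List (ℕ × ℕ × ℕ)
  S₃ = (1 , 2 , 3) ∷ (1 , 3 , 2) ∷ (2 , 1 , 3) ∷ (2 , 3 , 1) ∷ (3 , 1 , 2) ∷ (3 , 2 , 1) ∷ []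

  inv : ℕ → ℕ → ℕ
  inv a b = χ (b ℕ.<ᵇ a)

  sgn : ℕ × ℕ × ℕ → Carrier
  sgn (a , b , e) = pow (- 1#) (inv a b ℕ.+ inv a e ℕ.+ inv b e)

  Phi : ℕ → ℕ → Carrier → Carrier → Carrier → Carrier → Carrier → Carrier → Carrier → Carrier
  Phi n m u v c' d z w q = foldr _+_ 0# (map term S₃)
    where
    term : ℕ × ℕ × ℕ → Carrier
    term (σ₁ , σ₂ , σ₃) =
      sgn (σ₁ , σ₂ , σ₃)
        * pow (u * z) (σ₁ ℕ.∸ 1)
        * pow (v * d ⁻¹) (χ (σ₃ ℕ.≡ᵇ 1))
        * pow (c' * u ⁻¹) (χ (σ₁ ℕ.≡ᵇ 3))
        * pow (d * w) (3 ℕ.∸ σ₃)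
        * PhiY n m (+ σ₁ ℤ.- + 1) (+ σ₂ ℤ.- + 2) (+ σ₃ ℤ.- + 3) (z * q ⁻¹) (w * q ⁻¹) q

-- By linearity the identity splits over σ ∈ S₃: for y = σ − ρ one has
--   Σ_{r,s} K_{n,m;r,s}(Z,W) Φ_{r,s;y}(Z,W) = Z^{y₁} W^{-y₃} q^{|y|²/2} Φ_{n,m;y}(Z,W),  Z = z/q, W = w/q.
-- The substitution r → r + y₁, s → s − y₃ absorbs y into Z → Z q^{y₁−y₂}, W → W q^{y₂−y₃},
-- leaving the case y = 0.  There q-Chu–Vandermonde gives
--   (ZWq)_{r+s} / ((q)_r (q)_s (ZWq)_r (ZWq)_s) = Σ_t q^{(r−t)(s−t)} / ((q)_{r−t} (q)_{s−t} (q)_t (ZWq)_t),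
-- which cancels the cross term q^{-rs} of the kernel, so the sums over r and s separate and
-- are both evaluated by a limiting q-Chu–Vandermonde sum; the remaining sum over t is once
-- more q-Chu–Vandermonde.
module Submission where

open import Defs
open import Level using (Level)
open import Data.Nat as ℕ using (ℕ; zero; suc; z≤n; s≤s)
open import Data.Integer as ℤ using (ℤ; +_; -[1+_])
open import Relation.Nullary using (¬_; yes; no)
open import Algebra.Bundles using (CommutativeRing)
import Algebra.Properties.Ring as RingProperties
import Algebra.Properties.AbelianGroup as AbelianGroupProperties
import Algebra.Properties.Semiring.Mult.TCOptimised as Multiples
import Algebra.Solver.Ring as RingSolver
open import Algebra.Solver.Ring.AlmostCommutativeRing
  using (_-Raw-AlmostCommutative⟶_; fromCommutativeRing)
import Data.Integer.Properties as ℤ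
import Data.Integer.Tactic.RingSolver as ℤ-Solver
import Data.Nat.Properties as ℕ
import Data.Nat.Tactic.RingSolver as ℕ-Solver
open import Data.Maybe using (Maybe; just; nothing)
open import Data.Product using (∃; _,_)
open import Data.Sum using (_⊎_; inj₁; inj₂)
open import Relation.Binary.PropositionalEquality as ≡ using (_≡_)
import Relation.Binary.Reasoning.Setoid as SetoidReasoning

-- Two inductions, `vandermonde` and `vandermonde′`, supply every summation. Both multiply by 1 -
-- q^(n+1), nonzero by hypothesis, and split it at the t-th term as (q^t - q^(n+1)) + (1 - q^t): the
-- first part lowers the row index, the second shifts t. The parameter A has to move to Aq, so the
-- reciprocals enter as abstract sequences known only by first-order recurrences; passing to Aq is
-- then a shift of index, and the limiting sum is a specialisation, with no limit taken. The lattice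
-- shift is by natural numbers: a = y₁ = σ₁ - 1 and b = -y₃ = 3 - σ₃, with y₂ = b - a because y sums
-- to zero, and |y|²/2 = a² - ab + b². The exponents y₁ - y₂ and y₂ - y₃ may still be negative, so
-- the nonvanishing of 1 - xq^k is carried for all integers k. Since σ and ρ have the same norm,
-- |y|²/2 = -y·ρ = y₁ - y₃ = a + b. Hence each σ contributes exactly z^a w^b.

-- Polynomial identities in an arbitrary commutative ring

module IntegerCoefficients {a ℓ} (R : CommutativeRing a ℓ) where
  open CommutativeRing R hiding (zero)
  open Multiples semiring using (_×_; 1+×; ×-homo-+; ×1-homo-*)
  open RingProperties ring using (-‿distribˡ-*; -‿distribʳ-*; -0#≈0#; -‿involutive)
  open AbelianGroupProperties +-abelianGroup using (⁻¹-∙-comm)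
  open SetoidReasoning setoid

  fromℤ : ℤ → Carrier
  fromℤ (+ n)    = n × 1#
  fromℤ -[1+ n ] = - (suc n × 1#)

  fromℤ-neg : ∀ i → fromℤ (ℤ.- i) ≈ - fromℤ i
  fromℤ-neg (+ zero)  = sym -0#≈0#
  fromℤ-neg (+ suc n) = refl
  fromℤ-neg -[1+ n ]  = sym (-‿involutive _)

  private
    cancel-common : ∀ x y z → (x + y) - (x + z) ≈ y - z
    cancel-common x y z = begin
      (x + y) + - (x + z)     ≈⟨ +-cong (+-comm x y) (sym (⁻¹-∙-comm x z)) ⟩
      (y + x) + (- x + - z)   ≈⟨ +-assoc y x _ ⟩
      y + (x + (- x + - z))   ≈⟨ +-congˡ (+-assoc x (- x) (- z)) ⟨
      y + ((x + - x) + - z)   ≈⟨ +-congˡ (+-congʳ (-‿inverseʳ x)) ⟩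
      y + (0# + - z)          ≈⟨ +-congˡ (+-identityˡ _) ⟩
      y - z                   ∎

  fromℤ-⊖ : ∀ m n → fromℤ (m ℤ.⊖ n) ≈ m × 1# - n × 1#
  fromℤ-⊖ zero    zero    = sym (-‿inverseʳ 0#)
  fromℤ-⊖ zero    (suc n) = sym (+-identityˡ _)
  fromℤ-⊖ (suc m) zero    = sym (trans (+-congˡ -0#≈0#) (+-identityʳ _))
  fromℤ-⊖ (suc m) (suc n) = begin
    fromℤ (suc m ℤ.⊖ suc n)           ≡⟨ ≡.cong fromℤ (ℤ.[1+m]⊖[1+n]≡m⊖n m n) ⟩
    fromℤ (m ℤ.⊖ n)                   ≈⟨ fromℤ-⊖ m n ⟩
    m × 1# - n × 1#                   ≈⟨ cancel-common 1# _ _ ⟨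
    (1# + m × 1#) - (1# + n × 1#)     ≈⟨ +-cong (1+× m 1#) (-‿cong (1+× n 1#)) ⟨
    suc m × 1# - suc n × 1#           ∎

  fromℤ-+ : ∀ i j → fromℤ (i ℤ.+ j) ≈ fromℤ i + fromℤ j
  fromℤ-+ (+ m)    (+ n)    = ×-homo-+ 1# m n
  fromℤ-+ (+ m)    -[1+ n ] = fromℤ-⊖ m (suc n)
  fromℤ-+ -[1+ m ] (+ n)    = trans (fromℤ-⊖ n (suc m)) (+-comm _ _)
  fromℤ-+ -[1+ m ] -[1+ n ] = begin
    - (suc (suc (m ℕ.+ n)) × 1#)         ≡⟨ ≡.cong (λ k → - (suc k × 1#)) (ℕ.+-suc m n) ⟨
    - ((suc m ℕ.+ suc n) × 1#)           ≈⟨ -‿cong (×-homo-+ 1# (suc m) (suc n)) ⟩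
    - (suc m × 1# + suc n × 1#)          ≈⟨ ⁻¹-∙-comm _ _ ⟨
    - (suc m × 1#) + - (suc n × 1#)      ∎

  private
    fromℤ-+* : ∀ m j → fromℤ (+ m ℤ.* j) ≈ fromℤ (+ m) * fromℤ j
    fromℤ-+* m (+ n) = begin
      fromℤ (+ m ℤ.* + n)   ≡⟨ ≡.cong fromℤ (ℤ.pos-* m n) ⟨
      (m ℕ.* n) × 1#        ≈⟨ ×1-homo-* m n ⟩
      (m × 1#) * (n × 1#)   ∎
    fromℤ-+* m -[1+ n ] = begin
      fromℤ (+ m ℤ.* (ℤ.- + suc n))     ≡⟨ ≡.cong fromℤ (ℤ.neg-distribʳ-* (+ m) (+ suc n)) ⟨
      fromℤ (ℤ.- (+ m ℤ.* + suc n))     ≈⟨ fromℤ-neg (+ m ℤ.* + suc n) ⟩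
      - fromℤ (+ m ℤ.* + suc n)         ≈⟨ -‿cong (fromℤ-+* m (+ suc n)) ⟩
      - (fromℤ (+ m) * fromℤ (+ suc n)) ≈⟨ -‿distribʳ-* _ _ ⟩
      fromℤ (+ m) * - fromℤ (+ suc n)   ∎

  fromℤ-* : ∀ i j → fromℤ (i ℤ.* j) ≈ fromℤ i * fromℤ j
  fromℤ-* (+ m)    j = fromℤ-+* m j
  fromℤ-* -[1+ m ] j = begin
    fromℤ ((ℤ.- + suc m) ℤ.* j)     ≡⟨ ≡.cong fromℤ (ℤ.neg-distribˡ-* (+ suc m) j) ⟨
    fromℤ (ℤ.- (+ suc m ℤ.* j))     ≈⟨ fromℤ-neg (+ suc m ℤ.* j) ⟩
    - fromℤ (+ suc m ℤ.* j)         ≈⟨ -‿cong (fromℤ-+* (suc m) j) ⟩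
    - (fromℤ (+ suc m) * fromℤ j)   ≈⟨ -‿distribˡ-* _ _ ⟩
    - fromℤ (+ suc m) * fromℤ j     ∎

  private
    coefficients : ℤ.+-*-rawRing -Raw-AlmostCommutative⟶ fromCommutativeRing R
    coefficients = record
      { ⟦_⟧    = fromℤ
      ; +-homo = fromℤ-+
      ; *-homo = fromℤ-*
      ; -‿homo = fromℤ-neg
      ; 0-homo = refl
      ; 1-homo = refl
      }

    -- Equality in the ring is not assumed decidable, so the solver compares coefficients in ℤ.
    -- Answering `nothing` is sound even where distinct integers have equal images, as in positive
    -- characteristic.
    _≟_ : ∀ i j → Maybe (fromℤ i ≈ fromℤ j)
    i ≟ j with i ℤ.≟ j
    ... | yes i≡j = just (reflexive (≡.cong fromℤ i≡j))
    ... | no  _   = nothing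

  open RingSolver ℤ.+-*-rawRing (fromCommutativeRing R) coefficients _≟_ public
    using (Polynomial; solve; _:=_; _:+_; _:*_; _:-_; con)

  :1 : ∀ {n} → Polynomial n
  :1 = con (+ 1)

-- Powers, finite sums and q-shifted factorials over a field

module FieldLemmas {a ℓ} (F : Field a ℓ) where
  open Field F hiding (zero)
  open QCalculus F
  open IntegerCoefficients commutativeRing
  open SetoidReasoning setoid

  *-cancelˡ-nonzero : ∀ {x y z} → ¬ x ≈ 0# → x * y ≈ x * z → y ≈ z
  *-cancelˡ-nonzero {x} {y} {z} x≉0 xy≈xz = begin
    y                ≈⟨ unit y ⟩
    x ⁻¹ * (x * y)   ≈⟨ *-congˡ xy≈xz ⟩
    x ⁻¹ * (x * z)   ≈⟨ unit z ⟨
    z                ∎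
    where
    unit : ∀ t → t ≈ x ⁻¹ * (x * t)
    unit t = begin
      t                ≈⟨ *-identityˡ t ⟨
      1# * t           ≈⟨ *-congʳ (⁻¹-inverse x x≉0) ⟨
      x * x ⁻¹ * t     ≈⟨ solve 3 (λ x y t → x :* y :* t := y :* (x :* t)) refl x (x ⁻¹) t ⟩
      x ⁻¹ * (x * t)   ∎

  *-nonzero : ∀ {x y} → ¬ x ≈ 0# → ¬ y ≈ 0# → ¬ x * y ≈ 0#
  *-nonzero {x} x≉0 y≉0 xy≈0 = y≉0 (*-cancelˡ-nonzero x≉0 (trans xy≈0 (sym (zeroʳ x))))

  ⁻¹-unique : ∀ {x y} → ¬ x ≈ 0# → x * y ≈ 1# → y ≈ x ⁻¹
  ⁻¹-unique {x} x≉0 xy≈1 = *-cancelˡ-nonzero x≉0 (trans xy≈1 (sym (⁻¹-inverse x x≉0)))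

  pow-cong : ∀ {x y} n → x ≈ y → pow x n ≈ pow y n
  pow-cong zero    x≈y = refl
  pow-cong (suc n) x≈y = *-cong x≈y (pow-cong n x≈y)

  pow-+ : ∀ x m n → pow x (m ℕ.+ n) ≈ pow x m * pow x n
  pow-+ x zero    n = sym (*-identityˡ _)
  pow-+ x (suc m) n = trans (*-congˡ (pow-+ x m n)) (sym (*-assoc x _ _))

  pow-* : ∀ x y n → pow (x * y) n ≈ pow x n * pow y n
  pow-* x y zero    = sym (*-identityˡ 1#)
  pow-* x y (suc n) = trans (*-congˡ (pow-* x y n))
    (solve 4 (λ x y s t → x :* y :* (s :* t) := x :* s :* (y :* t)) refl x y (pow x n) (pow y n))

  pow-pow : ∀ x m n → pow (pow x m) n ≈ pow x (m ℕ.* n)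
  pow-pow x m zero    = reflexive (≡.sym (≡.cong (pow x) (ℕ.*-zeroʳ m)))
  pow-pow x m (suc n) = begin
    pow x m * pow (pow x m) n    ≈⟨ *-congˡ (pow-pow x m n) ⟩
    pow x m * pow x (m ℕ.* n)    ≈⟨ pow-+ x m (m ℕ.* n) ⟨
    pow x (m ℕ.+ m ℕ.* n)        ≡⟨ ≡.cong (pow x) (ℕ.*-suc m n) ⟨
    pow x (m ℕ.* suc n)          ∎

  pow-suc² : ∀ x n → pow x (suc n ℕ.* suc n) ≈ pow x (n ℕ.* n) * pow x n * pow x n * x
  pow-suc² x n = begin
    x * pow x (n ℕ.+ n ℕ.* suc n)             ≈⟨ *-congˡ (pow-+ x n (n ℕ.* suc n)) ⟩
    x * (pow x n * pow x (n ℕ.* suc n))       ≡⟨ ≡.cong (λ k → x * (pow x n * pow x k)) (ℕ.*-suc n n) ⟩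
    x * (pow x n * pow x (n ℕ.+ n ℕ.* n))     ≈⟨ *-congˡ (*-congˡ (pow-+ x n (n ℕ.* n))) ⟩
    x * (pow x n * (pow x n * pow x (n ℕ.* n)))
      ≈⟨ solve 3 (λ x s t → x :* (s :* (s :* t)) := t :* s :* s :* x) refl x (pow x n) (pow x (n ℕ.* n)) ⟩
    pow x (n ℕ.* n) * pow x n * pow x n * x   ∎

  zpow-suc : ∀ {x} → ¬ x ≈ 0# → ∀ k → zpow x (ℤ.suc k) ≈ x * zpow x k
  zpow-suc     x≉0 (+ n)        = refl
  zpow-suc {x} x≉0 -[1+ zero ]  = sym (trans (*-congˡ (*-identityʳ _)) (⁻¹-inverse x x≉0))
  zpow-suc {x} x≉0 -[1+ suc n ] = begin
    pow (x ⁻¹) (suc n)                  ≈⟨ *-identityˡ _ ⟨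
    1# * pow (x ⁻¹) (suc n)             ≈⟨ *-congʳ (⁻¹-inverse x x≉0) ⟨
    x * x ⁻¹ * pow (x ⁻¹) (suc n)       ≈⟨ *-assoc x _ _ ⟩
    x * (x ⁻¹ * pow (x ⁻¹) (suc n))     ∎

  zpow-+ : ∀ {x} → ¬ x ≈ 0# → ∀ i j → zpow x (i ℤ.+ j) ≈ zpow x i * zpow x j
  zpow-+ {x} x≉0 (+ zero) j = begin
    zpow x (ℤ.0ℤ ℤ.+ j)   ≡⟨ ≡.cong (zpow x) (ℤ.+-identityˡ j) ⟩
    zpow x j              ≈⟨ *-identityˡ _ ⟨
    1# * zpow x j         ∎
  zpow-+ {x} x≉0 (+ suc n) j = begin
    zpow x (+ suc n ℤ.+ j)           ≡⟨ ≡.cong (zpow x) (ℤ.+-assoc (+ 1) (+ n) j) ⟩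
    zpow x (ℤ.suc (+ n ℤ.+ j))       ≈⟨ zpow-suc x≉0 (+ n ℤ.+ j) ⟩
    x * zpow x (+ n ℤ.+ j)           ≈⟨ *-congˡ (zpow-+ x≉0 (+ n) j) ⟩
    x * (pow x n * zpow x j)         ≈⟨ *-assoc x _ _ ⟨
    x * pow x n * zpow x j           ∎
  zpow-+ {x} x≉0 -[1+ n ] j = *-cancelˡ-nonzero x≉0 (begin
    x * zpow x (-[1+ n ] ℤ.+ j)             ≈⟨ zpow-suc x≉0 (-[1+ n ] ℤ.+ j) ⟨
    zpow x (ℤ.suc (-[1+ n ] ℤ.+ j))         ≡⟨ ≡.cong (zpow x) (ℤ.+-assoc (+ 1) -[1+ n ] j) ⟨
    zpow x (ℤ.suc -[1+ n ] ℤ.+ j)           ≈⟨ step n ⟩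
    zpow x (ℤ.suc -[1+ n ]) * zpow x j      ≈⟨ *-congʳ (zpow-suc x≉0 -[1+ n ]) ⟩
    x * zpow x -[1+ n ] * zpow x j          ≈⟨ *-assoc x _ _ ⟩
    x * (zpow x -[1+ n ] * zpow x j)        ∎)
    where
    -- The successor of `-[1+ n ]` is 0 or `-[1+ n - 1 ]`; the case split exposes the smaller index
    -- to the recursion.
    step : ∀ n → zpow x (ℤ.suc -[1+ n ] ℤ.+ j) ≈ zpow x (ℤ.suc -[1+ n ]) * zpow x j
    step zero    = zpow-+ x≉0 (+ 0) j
    step (suc n) = zpow-+ x≉0 -[1+ n ] j

  sum-cong : ∀ n {f g : ℕ → Carrier} → (∀ i → i ℕ.≤ n → f i ≈ g i) → sumUpTo n f ≈ sumUpTo n g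
  sum-cong zero    f≈g = f≈g 0 z≤n
  sum-cong (suc n) f≈g =
    +-cong (sum-cong n (λ i i≤n → f≈g i (ℕ.m≤n⇒m≤1+n i≤n))) (f≈g (suc n) ℕ.≤-refl)

  sum-zero : ∀ n {f : ℕ → Carrier} → (∀ i → i ℕ.≤ n → f i ≈ 0#) → sumUpTo n f ≈ 0#
  sum-zero zero    f≈0 = f≈0 0 z≤n
  sum-zero (suc n) f≈0 =
    trans (+-cong (sum-zero n (λ i i≤n → f≈0 i (ℕ.m≤n⇒m≤1+n i≤n))) (f≈0 (suc n) ℕ.≤-refl))
          (+-identityˡ 0#)

  sum-+ : ∀ n (f g : ℕ → Carrier) → sumUpTo n (λ i → f i + g i) ≈ sumUpTo n f + sumUpTo n g
  sum-+ zero    f g = refl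
  sum-+ (suc n) f g = trans (+-congʳ (sum-+ n f g))
    (solve 4 (λ s t x y → s :+ t :+ (x :+ y) := s :+ x :+ (t :+ y)) refl _ _ _ _)

  sum-*ˡ : ∀ n x (f : ℕ → Carrier) → x * sumUpTo n f ≈ sumUpTo n (λ i → x * f i)
  sum-*ˡ zero    x f = refl
  sum-*ˡ (suc n) x f = trans (distribˡ x _ _) (+-congʳ (sum-*ˡ n x f))

  sum-*ʳ : ∀ n x (f : ℕ → Carrier) → sumUpTo n f * x ≈ sumUpTo n (λ i → f i * x)
  sum-*ʳ zero    x f = refl
  sum-*ʳ (suc n) x f = trans (distribʳ x _ _) (+-congʳ (sum-*ʳ n x f))

  sum-swap : ∀ m n (f : ℕ → ℕ → Carrier) →
    sumUpTo m (λ i → sumUpTo n (λ j → f i j)) ≈ sumUpTo n (λ j → sumUpTo m (λ i → f i j))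
  sum-swap zero    n f = refl
  sum-swap (suc m) n f = trans (+-congʳ (sum-swap m n f)) (sym (sum-+ n _ _))

  sum-suc : ∀ n (f : ℕ → Carrier) → sumUpTo (suc n) f ≈ f 0 + sumUpTo n (λ i → f (suc i))
  sum-suc zero    f = refl
  sum-suc (suc n) f = trans (+-congʳ (sum-suc n f)) (+-assoc _ _ _)

  sum-drop : ∀ k n (f : ℕ → Carrier) → (∀ i → i ℕ.< k → f i ≈ 0#) →
    sumUpTo (k ℕ.+ n) f ≈ sumUpTo n (λ i → f (k ℕ.+ i))
  sum-drop zero    n f f≈0 = refl
  sum-drop (suc k) n f f≈0 = begin
    sumUpTo (suc k ℕ.+ n) f                       ≈⟨ sum-suc (k ℕ.+ n) f ⟩
    f 0 + sumUpTo (k ℕ.+ n) (λ i → f (suc i))     ≈⟨ +-cong (f≈0 0 (s≤s z≤n))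
                                                       (sum-drop k n (λ i → f (suc i)) (λ i i<k → f≈0 (suc i) (s≤s i<k))) ⟩
    0# + sumUpTo n (λ i → f (suc k ℕ.+ i))        ≈⟨ +-identityˡ _ ⟩
    sumUpTo n (λ i → f (suc k ℕ.+ i))             ∎

  sum-truncate : ∀ k n (f : ℕ → Carrier) → (∀ i → n ℕ.< i → f i ≈ 0#) →
    sumUpTo (n ℕ.+ k) f ≈ sumUpTo n f
  sum-truncate zero    n f f≈0 = reflexive (≡.cong (λ l → sumUpTo l f) (ℕ.+-identityʳ n))
  sum-truncate (suc k) n f f≈0 = begin
    sumUpTo (n ℕ.+ suc k) f                   ≡⟨ ≡.cong (λ l → sumUpTo l f) (ℕ.+-suc n k) ⟩
    sumUpTo (n ℕ.+ k) f + f (suc (n ℕ.+ k))   ≈⟨ +-cong (sum-truncate k n f f≈0) (f≈0 _ (s≤s (ℕ.m≤m+n n k))) ⟩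
    sumUpTo n f + 0#                          ≈⟨ +-identityʳ _ ⟩
    sumUpTo n f                               ∎

  poch-cong : ∀ {x y} q n → x ≈ y → poch x q n ≈ poch y q n
  poch-cong q zero    x≈y = refl
  poch-cong q (suc n) x≈y = *-cong (poch-cong q n x≈y) (+-congˡ (-‿cong (*-congʳ x≈y)))

  poch-+ : ∀ x q m n → poch x q (m ℕ.+ n) ≈ poch x q m * poch (x * pow q m) q n
  poch-+ x q m zero = begin
    poch x q (m ℕ.+ 0)   ≡⟨ ≡.cong (poch x q) (ℕ.+-identityʳ m) ⟩
    poch x q m           ≈⟨ *-identityʳ _ ⟨
    poch x q m * 1#      ∎
  poch-+ x q m (suc n) = begin
    poch x q (m ℕ.+ suc n)
      ≡⟨ ≡.cong (poch x q) (ℕ.+-suc m n) ⟩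
    poch x q (m ℕ.+ n) * (1# - x * pow q (m ℕ.+ n))
      ≈⟨ *-cong (poch-+ x q m n) (+-congˡ (-‿cong (trans (*-congˡ (pow-+ q m n)) (sym (*-assoc x _ _))))) ⟩
    poch x q m * poch (x * pow q m) q n * (1# - x * pow q m * pow q n)
      ≈⟨ *-assoc _ _ _ ⟩
    poch x q m * poch (x * pow q m) q (suc n) ∎

  -- The definition peels off the last factor. Inductions that replace A by Aq need the first one
  -- peeled off instead.
  poch-suc : ∀ x q n → poch x q (suc n) ≈ (1# - x) * poch (x * q) q n
  poch-suc x q n = trans (poch-+ x q 1 n)
    (*-cong (solve 1 (λ x → :1 :* (:1 :- x :* :1) := :1 :- x) refl x)
            (poch-cong q n (*-congˡ (*-identityʳ q))))

  poch-0 : ∀ q n → poch 0# q n ≈ 1#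
  poch-0 q zero    = refl
  poch-0 q (suc n) = trans (*-congʳ (poch-0 q n))
    (solve 1 (λ x → :1 :* (:1 :- con (+ 0) :* x) := :1) refl (pow q n))

  poch-nonzero : ∀ {x q} → (∀ k → ¬ 1# - x * pow q k ≈ 0#) → ∀ n → ¬ poch x q n ≈ 0#
  poch-nonzero nz zero    = λ 1≈0 → 0≉1 (sym 1≈0)
  poch-nonzero nz (suc n) = *-nonzero (poch-nonzero nz n) (nz n)

  -- This recurrence is the only fact about 1/(x;q)_n that the summation lemmas take as input.
  recipPoch-suc : ∀ {x q} → (∀ k → ¬ 1# - x * pow q k ≈ 0#) → ∀ n →
    recipPoch x q (+ n) ≈ recipPoch x q (+ suc n) * (1# - x * pow q n)
  recipPoch-suc {x} {q} nz n = sym (⁻¹-unique (poch-nonzero nz n) (begin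
    poch x q n * (poch x q (suc n) ⁻¹ * (1# - x * pow q n))
      ≈⟨ solve 3 (λ p i s → p :* (i :* s) := p :* s :* i) refl _ _ _ ⟩
    poch x q (suc n) * poch x q (suc n) ⁻¹
      ≈⟨ ⁻¹-inverse _ (poch-nonzero nz (suc n)) ⟩
    1# ∎))

-- q-Chu-Vandermonde sums by q-Pascal induction

module QSums {a ℓ} (F : Field a ℓ) (q : Field.Carrier F)
  (q-nonroot : ∀ k → ¬ Field._≈_ F (Field._-_ F (Field.1# F) (QCalculus.pow F q (suc k))) (Field.0# F))
  where
  open Field F hiding (zero)
  open QCalculus F
  open IntegerCoefficients commutativeRing
  open FieldLemmas F
  open SetoidReasoning setoid

  -- rq⊖ n t is 1/(q;q)_{n-t}, with value 0 when t > n.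
  rq : ℕ → Carrier
  rq n = recipPoch q q (+ n)

  rq⊖ : ℕ → ℕ → Carrier
  rq⊖ n       zero    = rq n
  rq⊖ zero    (suc t) = 0#
  rq⊖ (suc n) (suc t) = rq⊖ n t

  rq-suc : ∀ n → rq n ≈ rq (suc n) * (1# - pow q (suc n))
  rq-suc = recipPoch-suc q-nonroot

  rq0 : rq 0 ≈ 1#
  rq0 = trans (sym (*-identityˡ _)) (⁻¹-inverse 1# (poch-nonzero {x = q} {q = q} q-nonroot 0))

  rq⊖-+ : ∀ t i j → rq⊖ (t ℕ.+ i) (t ℕ.+ j) ≡ rq⊖ i j
  rq⊖-+ zero    i j = ≡.refl
  rq⊖-+ (suc t) i j = rq⊖-+ t i j

  rq⊖-diff : ∀ t i → rq⊖ (t ℕ.+ i) t ≡ rq i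
  rq⊖-diff zero    i = ≡.refl
  rq⊖-diff (suc t) i = rq⊖-diff t i

  rq⊖-zero : ∀ {n t} → n ℕ.< t → rq⊖ n t ≡ 0#
  rq⊖-zero {zero}  {suc t} n<t       = ≡.refl
  rq⊖-zero {suc n} {suc t} (s≤s n<t) = rq⊖-zero n<t

  -- This is 1/(q;q)_(n-t-1) = (1 - q^(n-t))/(q;q)_(n-t), multiplied by q^t to keep exponents
  -- nonnegative. It needs no bound on t: at t = n the difference of powers vanishes, and beyond
  -- that both reciprocals do.
  rq⊖-suc : ∀ n t → pow q t * rq⊖ n (suc t) ≈ (pow q t - pow q n) * rq⊖ n t
  rq⊖-suc zero zero =
    solve 1 (λ x → :1 :* con (+ 0) := (:1 :- :1) :* x) refl (rq 0)
  rq⊖-suc zero (suc t) =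
    solve 2 (λ x y → x :* con (+ 0) := y :* con (+ 0)) refl _ _
  rq⊖-suc (suc n) zero = begin
    1# * rq n                                   ≈⟨ *-congˡ (rq-suc n) ⟩
    1# * (rq (suc n) * (1# - pow q (suc n)))    ≈⟨ solve 2 (λ x y → :1 :* (x :* y) := y :* x) refl _ _ ⟩
    (1# - pow q (suc n)) * rq (suc n)           ∎
  rq⊖-suc (suc n) (suc t) = begin
    q * pow q t * rq⊖ n (suc t)                 ≈⟨ *-assoc q _ _ ⟩
    q * (pow q t * rq⊖ n (suc t))               ≈⟨ *-congˡ (rq⊖-suc n t) ⟩
    q * ((pow q t - pow q n) * rq⊖ n t)
      ≈⟨ solve 4 (λ q x y z → q :* ((x :- y) :* z) := (q :* x :- q :* y) :* z) refl q (pow q t) (pow q n) _ ⟩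
    (q * pow q t - q * pow q n) * rq⊖ n t       ∎

  -- The q-Pascal recurrence summed against an arbitrary sequence. In 1 - q^(n+1) = (q^t - q^(n+1))
  -- + (1 - q^t) the first part turns 1/(q;q)_(n+1-t) into q^t/(q;q)_(n-t), and the second turns
  -- 1/(q;q)_t into 1/(q;q)_(t-1), after which t is reindexed. The boundary terms t = n + 1 and t =
  -- 0 vanish respectively.
  pascal-sum : ∀ n (c : ℕ → Carrier) →
    (1# - pow q (suc n)) * sumUpTo (suc n) (λ t → rq⊖ (suc n) t * rq t * c t)
      ≈ sumUpTo n (λ t → rq⊖ n t * rq t * (pow q t * c t + c (suc t)))
  pascal-sum n c = begin
    (1# - pow q (suc n)) * sumUpTo (suc n) (λ t → rq⊖ (suc n) t * rq t * c t)
      ≈⟨ sum-*ˡ (suc n) _ _ ⟩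
    sumUpTo (suc n) (λ t → (1# - pow q (suc n)) * (rq⊖ (suc n) t * rq t * c t))
      ≈⟨ sum-cong (suc n) (λ t _ → split t) ⟩
    sumUpTo (suc n) (λ t → lower t + upper t)
      ≈⟨ sum-+ (suc n) lower upper ⟩
    sumUpTo (suc n) lower + sumUpTo (suc n) upper
      ≈⟨ +-cong dropTop (sum-suc n upper) ⟩
    sumUpTo n lower + (upper 0 + sumUpTo n (λ t → upper (suc t)))
      ≈⟨ +-congˡ (trans (+-congʳ upper0) (+-identityˡ _)) ⟩
    sumUpTo n lower + sumUpTo n (λ t → upper (suc t))
      ≈⟨ sum-+ n _ _ ⟨
    sumUpTo n (λ t → lower t + upper (suc t))
      ≈⟨ sum-cong n (λ t _ → merge t) ⟩
    sumUpTo n (λ t → rq⊖ n t * rq t * (pow q t * c t + c (suc t))) ∎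
    where
    lower upper : ℕ → Carrier
    lower t = pow q t * rq⊖ n t * rq t * c t
    upper t = (1# - pow q t) * rq⊖ (suc n) t * rq t * c t

    split : ∀ t → (1# - pow q (suc n)) * (rq⊖ (suc n) t * rq t * c t) ≈ lower t + upper t
    split t = begin
      (1# - pow q (suc n)) * (rq⊖ (suc n) t * rq t * c t)
        ≈⟨ solve 5 (λ y x m r c → (:1 :- y) :* (m :* r :* c) := (x :- y) :* m :* r :* c :+ (:1 :- x) :* m :* r :* c)
             refl (pow q (suc n)) (pow q t) _ _ _ ⟩
      (pow q t - pow q (suc n)) * rq⊖ (suc n) t * rq t * c t + upper t
        ≈⟨ +-congʳ (*-congʳ (*-congʳ (rq⊖-suc (suc n) t))) ⟨
      lower t + upper t ∎

    dropTop : sumUpTo (suc n) lower ≈ sumUpTo n lower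
    dropTop = begin
      sumUpTo n lower + pow q (suc n) * rq⊖ n (suc n) * rq (suc n) * c (suc n)
        ≡⟨ ≡.cong (λ x → sumUpTo n lower + pow q (suc n) * x * rq (suc n) * c (suc n)) (rq⊖-zero (ℕ.n<1+n n)) ⟩
      sumUpTo n lower + pow q (suc n) * 0# * rq (suc n) * c (suc n)
        ≈⟨ solve 4 (λ s x y z → s :+ x :* con (+ 0) :* y :* z := s) refl (sumUpTo n lower) _ _ _ ⟩
      sumUpTo n lower ∎

    upper0 : upper 0 ≈ 0#
    upper0 = solve 3 (λ x y z → (:1 :- :1) :* x :* y :* z := con (+ 0)) refl _ _ _

    merge : ∀ t → lower t + upper (suc t) ≈ rq⊖ n t * rq t * (pow q t * c t + c (suc t))
    merge t = begin
      lower t + (1# - pow q (suc t)) * rq⊖ n t * rq (suc t) * c (suc t)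
        ≈⟨ +-congˡ (*-congʳ (trans (solve 3 (λ x y z → x :* y :* z := y :* (z :* x)) refl _ _ _)
                                   (*-congˡ (sym (rq-suc t))))) ⟩
      lower t + rq⊖ n t * rq t * c (suc t)
        ≈⟨ solve 5 (λ x m r c d → x :* m :* r :* c :+ m :* r :* d := m :* r :* (x :* c :+ d)) refl _ _ _ _ _ ⟩
      rq⊖ n t * rq t * (pow q t * c t + c (suc t)) ∎

  -- With h t = 1/(Aq;q)_t this is the q-Chu–Vandermonde sum; d stands for
  -- t ↦ 1/(q;q)_{m-t} with x = q^m, or for the constant 1 with x = 0.
  -- The two terms of pascal-sum combine into the same sum at Aq.
  vandermonde : ∀ n x A (d h : ℕ → Carrier) →
    (∀ t → pow q t * d (suc t) ≈ (pow q t - x) * d t) →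
    (∀ t → h t ≈ h (suc t) * (1# - A * q * pow q t)) →
    sumUpTo n (λ t → rq⊖ n t * rq t * (pow A t * pow q (t ℕ.* t) * d t * h t))
      ≈ rq n * poch (A * x * q) q n * h n * d 0
  vandermonde zero x A d h d-suc h-suc = begin
    rq 0 * rq 0 * (1# * 1# * d 0 * h 0)   ≈⟨ *-congʳ (*-congˡ rq0) ⟩
    rq 0 * 1# * (1# * 1# * d 0 * h 0)
      ≈⟨ solve 3 (λ r d h → r :* :1 :* (:1 :* :1 :* d :* h) := r :* :1 :* h :* d) refl _ _ _ ⟩
    rq 0 * 1# * h 0 * d 0                 ∎
  vandermonde (suc n) x A d h d-suc h-suc = *-cancelˡ-nonzero (q-nonroot n) (begin
    (1# - pow q (suc n)) * sumUpTo (suc n) (λ t → rq⊖ (suc n) t * rq t * c t)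
      ≈⟨ pascal-sum n c ⟩
    sumUpTo n (λ t → rq⊖ n t * rq t * (pow q t * c t + c (suc t)))
      ≈⟨ sum-cong n (λ t _ → trans (*-congˡ (combine t))
           (solve 3 (λ x y z → x :* (y :* z) := y :* (x :* z)) refl _ _ _)) ⟩
    sumUpTo n (λ t → (1# - A * x * q) * (rq⊖ n t * rq t * c′ t))
      ≈⟨ sum-*ˡ n _ _ ⟨
    (1# - A * x * q) * sumUpTo n (λ t → rq⊖ n t * rq t * c′ t)
      -- For h t = 1/(Aq;q)_t the shifted sequence is 1/(Aq²;q)_t up to a constant factor. Because h
      -- is constrained only by its recurrence, this normalisation is immaterial.
      ≈⟨ *-congˡ (vandermonde n x (A * q) d (λ t → h (suc t)) d-suc h-suc′) ⟩
    (1# - A * x * q) * (rq n * poch (A * q * x * q) q n * h (suc n) * d 0)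
      ≈⟨ *-congˡ (*-congʳ (*-congʳ (*-cong (rq-suc n)
           (poch-cong q n (solve 3 (λ A x q → A :* q :* x :* q := A :* x :* q :* q) refl A x q))))) ⟩
    (1# - A * x * q) * (rq (suc n) * (1# - pow q (suc n)) * poch (A * x * q * q) q n * h (suc n) * d 0)
      ≈⟨ solve 6 (λ s r p f h d → s :* (r :* p :* f :* h :* d) := p :* (r :* (s :* f) :* h :* d)) refl _ _ _ _ _ _ ⟩
    (1# - pow q (suc n)) * (rq (suc n) * ((1# - A * x * q) * poch (A * x * q * q) q n) * h (suc n) * d 0)
      ≈⟨ *-congˡ (*-congʳ (*-congʳ (*-congˡ (poch-suc (A * x * q) q n)))) ⟨
    (1# - pow q (suc n)) * (rq (suc n) * poch (A * x * q) q (suc n) * h (suc n) * d 0) ∎)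
    where
    c c′ : ℕ → Carrier
    c t  = pow A t * pow q (t ℕ.* t) * d t * h t
    c′ t = pow (A * q) t * pow q (t ℕ.* t) * d t * h (suc t)

    h-suc′ : ∀ t → h (suc t) ≈ h (suc (suc t)) * (1# - A * q * q * pow q t)
    h-suc′ t = trans (h-suc (suc t))
      (solve 4 (λ h A q x → h :* (:1 :- A :* q :* (q :* x)) := h :* (:1 :- A :* q :* q :* x)) refl _ A q (pow q t))

    -- The dependence on t cancels: (1 - Aq q^t) + Aq (q^t - x) = 1 - Axq, where the first summand
    -- comes from `h-suc` and the second from `d-suc`.
    combine : ∀ t → pow q t * c t + c (suc t) ≈ (1# - A * x * q) * c′ t
    combine t = begin
      Q * (α * S * d t * h t) + A * α * pow q (suc t ℕ.* suc t) * d (suc t) * h⁺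
        ≈⟨ +-cong (*-congˡ (*-congˡ (h-suc t))) (*-congʳ (*-congʳ (*-congˡ (pow-suc² q t)))) ⟩
      Q * (α * S * d t * (h⁺ * (1# - A * q * Q))) + A * α * (S * Q * Q * q) * d (suc t) * h⁺
        ≈⟨ +-congˡ (solve 7 (λ A α S Q q d h → A :* α :* (S :* Q :* Q :* q) :* d :* h := A :* α :* S :* Q :* q :* h :* (Q :* d))
             refl A α S Q q (d (suc t)) h⁺) ⟩
      Q * (α * S * d t * (h⁺ * (1# - A * q * Q))) + A * α * S * Q * q * h⁺ * (Q * d (suc t))
        ≈⟨ +-congˡ (*-congˡ (d-suc t)) ⟩
      Q * (α * S * d t * (h⁺ * (1# - A * q * Q))) + A * α * S * Q * q * h⁺ * ((Q - x) * d t)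
        ≈⟨ solve 8 (λ A α S Q q d h x →
             Q :* (α :* S :* d :* (h :* (:1 :- A :* q :* Q))) :+ A :* α :* S :* Q :* q :* h :* ((Q :- x) :* d)
               := (:1 :- A :* x :* q) :* (α :* Q :* S :* d :* h)) refl A α S Q q (d t) h⁺ x ⟩
      (1# - A * x * q) * (α * Q * S * d t * h⁺)
        ≈⟨ *-congˡ (*-congʳ (*-congʳ (*-congʳ (pow-* A q t)))) ⟨
      (1# - A * x * q) * c′ t ∎
      where
      α = pow A t
      S = pow q (t ℕ.* t)
      Q = pow q t
      h⁺ = h (suc t)

  -- q^{(r-t)(s-t)} / ((q;q)_{r-t} (q;q)_{s-t}), with value 0 when t > r or t > s.
  qPair : ℕ → ℕ → ℕ → Carrier
  qPair r s t = pow q ((r ℕ.∸ t) ℕ.* (s ℕ.∸ t)) * rq⊖ r t * rq⊖ s t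

  -- Lowering r + 1 to r lowers the exponent (r+1-t)(s-t) by s - t, and q^t q^(s-t) = q^s no longer
  -- depends on t. Out of range both sides are zero, so the truncated subtraction in `qPair` is
  -- harmless.
  qPair-suc : ∀ r s t → (pow q t - pow q (suc r)) * qPair (suc r) s t ≈ pow q s * qPair r s t
  qPair-suc r s zero = begin
    (1# - pow q (suc r)) * (pow q (s ℕ.+ r ℕ.* s) * rq (suc r) * rq s)
      ≈⟨ *-congˡ (*-congʳ (*-congʳ (pow-+ q s (r ℕ.* s)))) ⟩
    (1# - pow q (suc r)) * (pow q s * pow q (r ℕ.* s) * rq (suc r) * rq s)
      ≈⟨ solve 5 (λ p x y z w → p :* (x :* y :* z :* w) := x :* (y :* (z :* p) :* w)) refl _ _ _ _ _ ⟩
    pow q s * (pow q (r ℕ.* s) * (rq (suc r) * (1# - pow q (suc r))) * rq s)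
      ≈⟨ *-congˡ (*-congʳ (*-congˡ (rq-suc r))) ⟨
    pow q s * (pow q (r ℕ.* s) * rq r * rq s) ∎
  qPair-suc r zero (suc t) =
    solve 6 (λ p x y z u v → p :* (x :* y :* con (+ 0)) := z :* (u :* v :* con (+ 0))) refl _ _ _ _ _ _
  -- The boundary t = r + 1: on the left 1/(q;q)_0 does not vanish, but q^t - q^(r+1) does.
  qPair-suc zero (suc s) (suc zero) =
    solve 6 (λ q x y z u v → (q :* :1 :- q :* :1) :* x := y :* (z :* con (+ 0) :* u)) refl q _ _ _ _ (rq 0)
  qPair-suc zero (suc s) (suc (suc t)) =
    solve 6 (λ p x y z u v → p :* (x :* con (+ 0) :* y) := z :* (u :* con (+ 0) :* v)) refl _ _ _ _ _ _
  qPair-suc (suc r) (suc s) (suc t) = begin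
    (q * pow q t - q * pow q (suc r)) * qPair (suc r) s t
      ≈⟨ solve 4 (λ q x y z → (q :* x :- q :* y) :* z := q :* ((x :- y) :* z)) refl q (pow q t) (pow q (suc r)) (qPair (suc r) s t) ⟩
    q * ((pow q t - pow q (suc r)) * qPair (suc r) s t)
      ≈⟨ *-congˡ (qPair-suc r s t) ⟩
    q * (pow q s * qPair r s t)
      ≈⟨ *-assoc q _ _ ⟨
    q * pow q s * qPair r s t ∎

  qPair-zero : ∀ {r} s {t} → r ℕ.< t → qPair r s t ≈ 0#
  qPair-zero {r} s {t} r<t = begin
    pow q ((r ℕ.∸ t) ℕ.* (s ℕ.∸ t)) * rq⊖ r t * rq⊖ s t
      ≡⟨ ≡.cong (λ x → pow q ((r ℕ.∸ t) ℕ.* (s ℕ.∸ t)) * x * rq⊖ s t) (rq⊖-zero r<t) ⟩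
    pow q ((r ℕ.∸ t) ℕ.* (s ℕ.∸ t)) * 0# * rq⊖ s t
      ≈⟨ solve 2 (λ x y → x :* con (+ 0) :* y := con (+ 0)) refl _ _ ⟩
    0# ∎

  -- For h t = 1/(Aq;q)_t, dividing by (Aq;q)_r would give the symmetric expansion of
  -- (Aq;q)_(r+s)/((q;q)_r (q;q)_s (Aq;q)_r (Aq;q)_s). In the induction on r, the part that lowers r
  -- keeps s and A and gains q^s; the part that shifts t leads to s - 1 and Aq, so s and A must stay
  -- general.
  vandermonde′ : ∀ r s A (h : ℕ → Carrier) →
    (∀ t → h t ≈ h (suc t) * (1# - A * q * pow q t)) →
    sumUpTo r (λ t → qPair r s t * rq t * h t)
      ≈ rq r * rq s * poch (A * q * pow q r) q s * h s
  vandermonde′ zero s A h h-suc = begin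
    1# * rq 0 * rq s * rq 0 * h 0     ≈⟨ *-cong (*-congˡ rq0) (h0 s) ⟩
    1# * rq 0 * rq s * 1# * (poch (A * q) q s * h s)
      ≈⟨ solve 4 (λ x y p h → :1 :* x :* y :* :1 :* (p :* h) := x :* y :* p :* h) refl _ _ _ _ ⟩
    rq 0 * rq s * poch (A * q) q s * h s
      ≈⟨ *-congʳ (*-congˡ (poch-cong q s (*-identityʳ _))) ⟨
    rq 0 * rq s * poch (A * q * 1#) q s * h s ∎
    where
    h0 : ∀ s → h 0 ≈ poch (A * q) q s * h s
    h0 zero    = sym (*-identityˡ _)
    h0 (suc s) = trans (h0 s) (trans (*-congˡ (h-suc s))
      (solve 3 (λ x y z → x :* (y :* z) := x :* z :* y) refl _ _ _))
  vandermonde′ (suc r) s A h h-suc = *-cancelˡ-nonzero (q-nonroot r) (begin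
    (1# - pow q (suc r)) * sumUpTo (suc r) (λ t → qPair (suc r) s t * rq t * h t)
      ≈⟨ sum-*ˡ (suc r) _ _ ⟩
    sumUpTo (suc r) (λ t → (1# - pow q (suc r)) * (qPair (suc r) s t * rq t * h t))
      ≈⟨ sum-cong (suc r) (λ t _ → split t) ⟩
    sumUpTo (suc r) (λ t → pow q s * lower t + upper t)
      ≈⟨ sum-+ (suc r) _ upper ⟩
    sumUpTo (suc r) (λ t → pow q s * lower t) + sumUpTo (suc r) upper
      ≈⟨ +-cong (sym (sum-*ˡ (suc r) _ lower)) (sum-suc r upper) ⟩
    pow q s * sumUpTo (suc r) lower + (upper 0 + sumUpTo r (λ t → upper (suc t)))
      ≈⟨ +-cong (*-congˡ (trans (+-congˡ lower-top) (+-identityʳ _))) (trans (+-congʳ upper0) (+-identityˡ _)) ⟩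
    pow q s * sumUpTo r lower + sumUpTo r (λ t → upper (suc t))
      ≈⟨ +-cong (*-congˡ (vandermonde′ r s A h h-suc)) (sum-cong r (λ t _ → upper-suc t)) ⟩
    pow q s * (rq r * rq s * poch (A * q * pow q r) q s * h s)
      + sumUpTo r (λ t → qPair (suc r) s (suc t) * rq t * h (suc t))
      ≈⟨ finish s ⟩
    (1# - pow q (suc r)) * (rq (suc r) * rq s * poch (A * q * pow q (suc r)) q s * h s) ∎)
    where
    lower upper : ℕ → Carrier
    lower t = qPair r s t * rq t * h t
    upper t = (1# - pow q t) * qPair (suc r) s t * rq t * h t

    split : ∀ t → (1# - pow q (suc r)) * (qPair (suc r) s t * rq t * h t) ≈ pow q s * lower t + upper t
    split t = begin
      (1# - pow q (suc r)) * (qPair (suc r) s t * rq t * h t)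
        ≈⟨ solve 5 (λ y x m r c → (:1 :- y) :* (m :* r :* c) := (x :- y) :* m :* r :* c :+ (:1 :- x) :* m :* r :* c)
             refl (pow q (suc r)) (pow q t) (qPair (suc r) s t) (rq t) (h t) ⟩
      (pow q t - pow q (suc r)) * qPair (suc r) s t * rq t * h t + upper t
        ≈⟨ +-congʳ (*-congʳ (*-congʳ (qPair-suc r s t))) ⟩
      pow q s * qPair r s t * rq t * h t + upper t
        ≈⟨ +-congʳ (solve 4 (λ x y z w → x :* y :* z :* w := x :* (y :* z :* w)) refl _ (qPair r s t) _ _) ⟩
      pow q s * lower t + upper t ∎

    lower-top : lower (suc r) ≈ 0#
    lower-top = trans (*-congʳ (*-congʳ (qPair-zero s (ℕ.n<1+n r))))
      (solve 2 (λ x y → con (+ 0) :* x :* y := con (+ 0)) refl _ _)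

    upper0 : upper 0 ≈ 0#
    upper0 = solve 3 (λ x y z → (:1 :- :1) :* x :* y :* z := con (+ 0)) refl (qPair (suc r) s 0) _ _

    upper-suc : ∀ t → upper (suc t) ≈ qPair (suc r) s (suc t) * rq t * h (suc t)
    upper-suc t = *-congʳ (trans
      (solve 3 (λ x y z → x :* y :* z := y :* (z :* x)) refl _ (qPair (suc r) s (suc t)) _)
      (*-congˡ (sym (rq-suc t))))

    -- The second sum belongs to s - 1, hence the case split; at s = 0 each of its terms contains
    -- 1/(q;q)_(-t-1) = 0.
    finish : ∀ s →
      pow q s * (rq r * rq s * poch (A * q * pow q r) q s * h s)
        + sumUpTo r (λ t → qPair (suc r) s (suc t) * rq t * h (suc t))
      ≈ (1# - pow q (suc r)) * (rq (suc r) * rq s * poch (A * q * pow q (suc r)) q s * h s)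
    finish zero = begin
      1# * (rq r * rq 0 * 1# * h 0) + sumUpTo r (λ t → qPair (suc r) 0 (suc t) * rq t * h (suc t))
        ≈⟨ +-cong (*-congˡ (*-congʳ (*-congʳ (*-congʳ (rq-suc r)))))
             (sum-zero r (λ t _ → solve 4 (λ x y z w → x :* y :* con (+ 0) :* z :* w := con (+ 0)) refl _ _ _ _)) ⟩
      1# * (rq (suc r) * (1# - pow q (suc r)) * rq 0 * 1# * h 0) + 0#
        ≈⟨ solve 4 (λ x p y h → :1 :* (x :* p :* y :* :1 :* h) :+ con (+ 0) := p :* (x :* y :* :1 :* h)) refl _ _ _ _ ⟩
      (1# - pow q (suc r)) * (rq (suc r) * rq 0 * 1# * h 0) ∎
    finish (suc s) = begin
      pow q (suc s) * (rq r * rq (suc s) * poch (A * q * pow q r) q (suc s) * h (suc s))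
        + sumUpTo r (λ t → qPair r s t * rq t * h (suc t))
        ≈⟨ +-cong (*-congˡ (*-congʳ (*-congˡ (trans (poch-suc (A * q * pow q r) q s)
                     (*-congˡ (poch-cong q s
                       (solve 3 (λ A q Q → A :* q :* Q :* q := A :* q :* (q :* Q)) refl A q (pow q r))))))))
             (trans (vandermonde′ r s (A * q) (λ t → h (suc t)) h-suc′)
               (*-congʳ (*-cong (*-congˡ (rq-suc s)) (poch-cong q s
                 (solve 3 (λ A q Q → A :* q :* q :* Q := A :* q :* (q :* Q)) refl A q (pow q r)))))) ⟩
      pow q (suc s) * (rq r * rq (suc s) * ((1# - A * q * pow q r) * P) * h (suc s))
        + rq r * (rq (suc s) * (1# - pow q (suc s))) * P * h (suc s)
        -- The two contributions combine by q^(s+1) (1 - Aq^(r+1)) + (1 - q^(s+1)) = 1 - Aq^(r+s+2),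
        -- the last factor of (Aq^(r+2);q)_(s+1).
        ≈⟨ solve 8 (λ A q R S ρ σ P h →
             q :* S :* (ρ :* σ :* ((:1 :- A :* q :* R) :* P) :* h) :+ ρ :* (σ :* (:1 :- q :* S)) :* P :* h
               := ρ :* σ :* (P :* (:1 :- A :* q :* (q :* R) :* S)) :* h)
             refl A q (pow q r) (pow q s) (rq r) (rq (suc s)) P (h (suc s)) ⟩
      rq r * rq (suc s) * poch (A * q * pow q (suc r)) q (suc s) * h (suc s)
        ≈⟨ *-congʳ (*-congʳ (*-congʳ (rq-suc r))) ⟩
      rq (suc r) * (1# - pow q (suc r)) * rq (suc s) * poch (A * q * pow q (suc r)) q (suc s) * h (suc s)
        ≈⟨ solve 5 (λ x p y f h → x :* p :* y :* f :* h := p :* (x :* y :* f :* h)) refl _ _ _ _ _ ⟩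
      (1# - pow q (suc r)) * (rq (suc r) * rq (suc s) * poch (A * q * pow q (suc r)) q (suc s) * h (suc s)) ∎
      where
      P = poch (A * q * pow q (suc r)) q s

      h-suc′ : ∀ t → h (suc t) ≈ h (suc (suc t)) * (1# - A * q * q * pow q t)
      h-suc′ t = trans (h-suc (suc t))
        (solve 4 (λ h A q x → h :* (:1 :- A :* q :* (q :* x)) := h :* (:1 :- A :* q :* q :* x)) refl _ A q (pow q t))

-- The dichotomy behind all boundary cases: either 1/(q;q)_(n-t) is zero, or n can be replaced by t
-- + k so that no subtraction remains.
<⊎∃+ : ∀ n t → n ℕ.< t ⊎ ∃ λ k → n ≡ t ℕ.+ k
<⊎∃+ n t with ℕ.<-≤-connex n t
... | inj₁ n<t = inj₁ n<t
... | inj₂ t≤n = inj₂ (n ℕ.∸ t , ≡.sym (ℕ.m+[n∸m]≡n t≤n))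

quad : ℕ → ℕ → ℤ
quad r s = + (r ℕ.* r) ℤ.- + (r ℕ.* s) ℤ.+ + (s ℕ.* s)

-- Polarisation of r² - rs + s². The linear coefficients 2a - b and 2b - a are y₁ - y₂ and y₂ - y₃,
-- the powers of q to be absorbed into Z and W.
quad-+ : ∀ a b i j →
  quad (a ℕ.+ i) (b ℕ.+ j)
    ≡ quad a b ℤ.+ ((+ a ℤ.+ + a ℤ.- + b) ℤ.* + i ℤ.+ (+ b ℤ.+ + b ℤ.- + a) ℤ.* + j ℤ.+ quad i j)
quad-+ a b i j = begin
  quad (a ℕ.+ i) (b ℕ.+ j)                         ≡⟨ quad-ℤ (a ℕ.+ i) (b ℕ.+ j) ⟩
  quadℤ (+ a ℤ.+ + i) (+ b ℤ.+ + j)                ≡⟨ expand (+ a) (+ b) (+ i) (+ j) ⟩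
  quadℤ (+ a) (+ b) ℤ.+ (cross ℤ.+ quadℤ (+ i) (+ j)) ≡⟨ ≡.cong₂ (λ x y → x ℤ.+ (cross ℤ.+ y)) (quad-ℤ a b) (quad-ℤ i j) ⟨
  quad a b ℤ.+ (cross ℤ.+ quad i j)                ∎
  where
  open ≡.≡-Reasoning
  quadℤ : ℤ → ℤ → ℤ
  quadℤ x y = x ℤ.* x ℤ.- x ℤ.* y ℤ.+ y ℤ.* y

  cross = (+ a ℤ.+ + a ℤ.- + b) ℤ.* + i ℤ.+ (+ b ℤ.+ + b ℤ.- + a) ℤ.* + j

  quad-ℤ : ∀ r s → quad r s ≡ quadℤ (+ r) (+ s)
  quad-ℤ r s = ≡.cong₂ ℤ._+_ (≡.cong₂ ℤ._-_ (ℤ.pos-* r r) (ℤ.pos-* r s)) (ℤ.pos-* s s)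

  expand : ∀ a b i j → (a ℤ.+ i) ℤ.* (a ℤ.+ i) ℤ.- (a ℤ.+ i) ℤ.* (b ℤ.+ j) ℤ.+ (b ℤ.+ j) ℤ.* (b ℤ.+ j)
    ≡ (a ℤ.* a ℤ.- a ℤ.* b ℤ.+ b ℤ.* b)
      ℤ.+ ((a ℤ.+ a ℤ.- b) ℤ.* i ℤ.+ (b ℤ.+ b ℤ.- a) ℤ.* j ℤ.+ (i ℤ.* i ℤ.- i ℤ.* j ℤ.+ j ℤ.* j))
  expand = ℤ-Solver.solve-∀

-- With r = t + i and s = t + j this reads r² - rs + s² + (r-t)(s-t) = t² + r(r-t) + s(s-t), which
-- has no mixed term in r and s.
quad-diagonal : ∀ t i j →
  quad (t ℕ.+ i) (t ℕ.+ j) ℤ.+ + (i ℕ.* j)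
    ≡ + (t ℕ.* t ℕ.+ (t ℕ.+ i) ℕ.* i ℕ.+ (t ℕ.+ j) ℕ.* j)
quad-diagonal t i j = begin
  A ℤ.- B ℤ.+ C ℤ.+ D   ≡⟨ move A B C D ⟩
  A ℤ.+ C ℤ.+ D ℤ.- B   ≡⟨ ≡.cong (λ k → + k ℤ.- B) (balance t i j) ⟩
  N ℤ.+ B ℤ.- B         ≡⟨ cancel N B ⟩
  N                     ∎
  where
  open ≡.≡-Reasoning
  A = + ((t ℕ.+ i) ℕ.* (t ℕ.+ i))
  B = + ((t ℕ.+ i) ℕ.* (t ℕ.+ j))
  C = + ((t ℕ.+ j) ℕ.* (t ℕ.+ j))
  D = + (i ℕ.* j)
  N = + (t ℕ.* t ℕ.+ (t ℕ.+ i) ℕ.* i ℕ.+ (t ℕ.+ j) ℕ.* j)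

  move : ∀ a b c d → a ℤ.- b ℤ.+ c ℤ.+ d ≡ a ℤ.+ c ℤ.+ d ℤ.- b
  move = ℤ-Solver.solve-∀

  cancel : ∀ n b → n ℤ.+ b ℤ.- b ≡ n
  cancel = ℤ-Solver.solve-∀

  balance : ∀ t i j →
    (t ℕ.+ i) ℕ.* (t ℕ.+ i) ℕ.+ (t ℕ.+ j) ℕ.* (t ℕ.+ j) ℕ.+ i ℕ.* j
      ≡ t ℕ.* t ℕ.+ (t ℕ.+ i) ℕ.* i ℕ.+ (t ℕ.+ j) ℕ.* j ℕ.+ (t ℕ.+ i) ℕ.* (t ℕ.+ j)
  balance = ℕ-Solver.solve-∀

-- The kernel sum at y = 0

module BaileyKernel {a ℓ} (F : Field a ℓ) (q : Field.Carrier F)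
  (q-nonroot : ∀ k → ¬ Field._≈_ F (Field._-_ F (Field.1# F) (QCalculus.pow F q (suc k))) (Field.0# F))
  (q≉0 : ¬ Field._≈_ F q (Field.0# F))
  where
  open Field F hiding (zero)
  open QCalculus F
  open IntegerCoefficients commutativeRing
  open FieldLemmas F
  open QSums F q q-nonroot
  open SetoidReasoning setoid

  -- For t > n both sides vanish. Otherwise r = t + i turns q^(r(r-t)) into (q^t)^i q^(i²), and what
  -- remains is a finite form of Cauchy's Durfee square identity with Z replaced by Zq^t.
  gauss-sum : ∀ n t Z (f : ℕ → Carrier) →
    (∀ r → f r ≈ f (suc r) * (1# - Z * q * pow q r)) →
    sumUpTo n (λ r → rq⊖ n r * (pow Z r * pow q (r ℕ.* (r ℕ.∸ t)) * rq⊖ r t * f r))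
      ≈ pow Z t * rq⊖ n t * f n
  gauss-sum n t Z f f-suc with <⊎∃+ n t
  ... | inj₁ n<t = begin
    sumUpTo n (λ r → rq⊖ n r * (pow Z r * pow q (r ℕ.* (r ℕ.∸ t)) * rq⊖ r t * f r))
      ≈⟨ sum-zero n (λ r r≤n → trans
           (*-congˡ (*-congʳ (*-congˡ (reflexive (rq⊖-zero (ℕ.≤-<-trans r≤n n<t))))))
           (solve 4 (λ x y z w → x :* (y :* z :* con (+ 0) :* w) := con (+ 0)) refl _ _ _ _)) ⟩
    0#
      ≈⟨ solve 2 (λ x y → con (+ 0) := x :* con (+ 0) :* y) refl (pow Z t) (f n) ⟩
    pow Z t * 0# * f n
      ≡⟨ ≡.cong (λ x → pow Z t * x * f n) (rq⊖-zero n<t) ⟨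
    pow Z t * rq⊖ n t * f n ∎
  ... | inj₂ (k , ≡.refl) = begin
    sumUpTo (t ℕ.+ k) (λ r → rq⊖ (t ℕ.+ k) r * (pow Z r * pow q (r ℕ.* (r ℕ.∸ t)) * rq⊖ r t * f r))
      ≈⟨ sum-drop t k _ (λ r r<t → trans
           (*-congˡ (*-congʳ (*-congˡ (reflexive (rq⊖-zero r<t)))))
           (solve 4 (λ x y z w → x :* (y :* z :* con (+ 0) :* w) := con (+ 0)) refl _ _ _ _)) ⟩
    sumUpTo k (λ i → rq⊖ (t ℕ.+ k) (t ℕ.+ i)
      * (pow Z (t ℕ.+ i) * pow q ((t ℕ.+ i) ℕ.* (t ℕ.+ i ℕ.∸ t)) * rq⊖ (t ℕ.+ i) t * f (t ℕ.+ i)))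
      ≈⟨ sum-cong k (λ i _ → shift i) ⟩
    sumUpTo k (λ i → pow Z t * (rq⊖ k i * rq i * (pow (Z * pow q t) i * pow q (i ℕ.* i) * 1# * f (t ℕ.+ i))))
      ≈⟨ sum-*ˡ k _ _ ⟨
    pow Z t * sumUpTo k (λ i → rq⊖ k i * rq i * (pow (Z * pow q t) i * pow q (i ℕ.* i) * 1# * f (t ℕ.+ i)))
      -- The limiting case: x = 0 with d constantly 1, where the product on the right collapses to
      -- (0;q)_k = 1.
      ≈⟨ *-congˡ (vandermonde k 0# (Z * pow q t) (λ _ → 1#) (λ i → f (t ℕ.+ i))
           (λ i → solve 1 (λ x → x :* :1 := (x :- con (+ 0)) :* :1) refl (pow q i)) f-suc′) ⟩
    pow Z t * (rq k * poch (Z * pow q t * 0# * q) q k * f (t ℕ.+ k) * 1#)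
      ≈⟨ *-congˡ (*-congʳ (*-congʳ (*-congˡ (trans
           (poch-cong q k (solve 2 (λ x y → x :* con (+ 0) :* y := con (+ 0)) refl _ _))
           (poch-0 q k))))) ⟩
    pow Z t * (rq k * 1# * f (t ℕ.+ k) * 1#)
      ≈⟨ solve 3 (λ x y z → x :* (y :* :1 :* z :* :1) := x :* y :* z) refl _ _ _ ⟩
    pow Z t * rq k * f (t ℕ.+ k)
      ≡⟨ ≡.cong (λ x → pow Z t * x * f (t ℕ.+ k)) (rq⊖-diff t k) ⟨
    pow Z t * rq⊖ (t ℕ.+ k) t * f (t ℕ.+ k) ∎
    where
    f-suc′ : ∀ i → f (t ℕ.+ i) ≈ f (t ℕ.+ suc i) * (1# - Z * pow q t * q * pow q i)
    f-suc′ i = begin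
      f (t ℕ.+ i)
        ≈⟨ f-suc (t ℕ.+ i) ⟩
      f (suc (t ℕ.+ i)) * (1# - Z * q * pow q (t ℕ.+ i))
        ≈⟨ *-cong (reflexive (≡.cong f (≡.sym (ℕ.+-suc t i)))) (+-congˡ (-‿cong (trans (*-congˡ (pow-+ q t i))
             (solve 4 (λ Z q x y → Z :* q :* (x :* y) := Z :* x :* q :* y) refl Z q _ _)))) ⟩
      f (t ℕ.+ suc i) * (1# - Z * pow q t * q * pow q i) ∎

    shift : ∀ i → rq⊖ (t ℕ.+ k) (t ℕ.+ i)
        * (pow Z (t ℕ.+ i) * pow q ((t ℕ.+ i) ℕ.* (t ℕ.+ i ℕ.∸ t)) * rq⊖ (t ℕ.+ i) t * f (t ℕ.+ i))
      ≈ pow Z t * (rq⊖ k i * rq i * (pow (Z * pow q t) i * pow q (i ℕ.* i) * 1# * f (t ℕ.+ i)))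
    shift i rewrite rq⊖-+ t k i | rq⊖-diff t i | ℕ.m+n∸m≡n t i = begin
      rq⊖ k i * (pow Z (t ℕ.+ i) * pow q ((t ℕ.+ i) ℕ.* i) * rq i * f (t ℕ.+ i))
        ≈⟨ *-congˡ (*-congʳ (*-congʳ (*-cong (pow-+ Z t i) split))) ⟩
      rq⊖ k i * (pow Z t * pow Z i * (pow (pow q t) i * pow q (i ℕ.* i)) * rq i * f (t ℕ.+ i))
        ≈⟨ solve 7 (λ n x y u v r f → n :* (x :* y :* (u :* v) :* r :* f) := x :* (n :* r :* (y :* u :* v :* :1 :* f)))
             refl _ _ _ _ _ _ _ ⟩
      pow Z t * (rq⊖ k i * rq i * (pow Z i * pow (pow q t) i * pow q (i ℕ.* i) * 1# * f (t ℕ.+ i)))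
        ≈⟨ *-congˡ (*-congˡ (*-congʳ (*-congʳ (*-congʳ (pow-* Z (pow q t) i))))) ⟨
      pow Z t * (rq⊖ k i * rq i * (pow (Z * pow q t) i * pow q (i ℕ.* i) * 1# * f (t ℕ.+ i))) ∎
      where
      split : pow q ((t ℕ.+ i) ℕ.* i) ≈ pow (pow q t) i * pow q (i ℕ.* i)
      split = begin
        pow q ((t ℕ.+ i) ℕ.* i)             ≡⟨ ≡.cong (pow q) (ℕ.*-distribʳ-+ i t i) ⟩
        pow q (t ℕ.* i ℕ.+ i ℕ.* i)         ≈⟨ pow-+ q (t ℕ.* i) (i ℕ.* i) ⟩
        pow q (t ℕ.* i) * pow q (i ℕ.* i)   ≈⟨ *-congʳ (pow-pow q t i) ⟨
        pow (pow q t) i * pow q (i ℕ.* i)   ∎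

  -- This is the separation of variables: each bracket on the right involves only one of r and s.
  -- When t exceeds either, a zero reciprocal on both sides makes the truncated exponents
  -- irrelevant.
  quad-qPair : ∀ r s t →
    zpow q (quad r s) * qPair r s t
      ≈ pow q (t ℕ.* t) * (pow q (r ℕ.* (r ℕ.∸ t)) * rq⊖ r t) * (pow q (s ℕ.* (s ℕ.∸ t)) * rq⊖ s t)
  quad-qPair r s t with <⊎∃+ r t | <⊎∃+ s t
  ... | inj₁ r<t | _ rewrite rq⊖-zero r<t =
    solve 6 (λ x y z u v w → x :* (y :* con (+ 0) :* z) := u :* (v :* con (+ 0)) :* w) refl _ _ _ _ _ _
  ... | inj₂ _ | inj₁ s<t rewrite rq⊖-zero s<t =
    solve 6 (λ x y z u v w → x :* (y :* z :* con (+ 0)) := u :* v :* (w :* con (+ 0))) refl _ _ _ _ _ _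
  ... | inj₂ (i , ≡.refl) | inj₂ (j , ≡.refl)
    rewrite ℕ.m+n∸m≡n t i | ℕ.m+n∸m≡n t j = begin
    zpow q (quad (t ℕ.+ i) (t ℕ.+ j)) * (pow q (i ℕ.* j) * x * y)
      ≈⟨ solve 4 (λ a b x y → a :* (b :* x :* y) := a :* b :* (x :* y)) refl _ _ x y ⟩
    zpow q (quad (t ℕ.+ i) (t ℕ.+ j)) * pow q (i ℕ.* j) * (x * y)
      ≈⟨ *-congʳ (zpow-+ q≉0 (quad (t ℕ.+ i) (t ℕ.+ j)) (+ (i ℕ.* j))) ⟨
    zpow q (quad (t ℕ.+ i) (t ℕ.+ j) ℤ.+ + (i ℕ.* j)) * (x * y)
      ≡⟨ ≡.cong (λ k → zpow q k * (x * y)) (quad-diagonal t i j) ⟩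
    pow q (t ℕ.* t ℕ.+ (t ℕ.+ i) ℕ.* i ℕ.+ (t ℕ.+ j) ℕ.* j) * (x * y)
      ≈⟨ *-congʳ (trans (pow-+ q (t ℕ.* t ℕ.+ (t ℕ.+ i) ℕ.* i) _) (*-congʳ (pow-+ q (t ℕ.* t) _))) ⟩
    pow q (t ℕ.* t) * pow q ((t ℕ.+ i) ℕ.* i) * pow q ((t ℕ.+ j) ℕ.* j) * (x * y)
      ≈⟨ solve 5 (λ a b c x y → a :* b :* c :* (x :* y) := a :* (b :* x) :* (c :* y)) refl _ _ _ x y ⟩
    pow q (t ℕ.* t) * (pow q ((t ℕ.+ i) ℕ.* i) * x) * (pow q ((t ℕ.+ j) ℕ.* j) * y) ∎
    where
    x = rq⊖ (t ℕ.+ i) t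
    y = rq⊖ (t ℕ.+ j) t

  -- K and PhiY at y = 0 with every 1/(q;q)_k written through rq⊖.
  K₀ : ℕ → ℕ → ℕ → ℕ → Carrier → Carrier → Carrier
  K₀ n m r s Z W = pow Z r * pow W s * zpow q (quad r s) * rq⊖ n r * rq⊖ m s

  Phi₀ : ℕ → ℕ → Carrier → Carrier → Carrier
  Phi₀ n m Z W =
    poch (Z * W * q) q (n ℕ.+ m)
      * rq n * recipPoch (Z * q) q (+ n) * recipPoch (Z * W * q) q (+ n)
      * rq m * recipPoch (W * q) q (+ m) * recipPoch (Z * W * q) q (+ m)

  module _ (Z W : Carrier)
    (Z-nonroot : ∀ k → ¬ 1# - Z * q * pow q k ≈ 0#)
    (W-nonroot : ∀ k → ¬ 1# - W * q * pow q k ≈ 0#)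
    (ZW-nonroot : ∀ k → ¬ 1# - Z * W * q * pow q k ≈ 0#)
    where

    private
      A = Z * W
      f g h : ℕ → Carrier
      f n = recipPoch (Z * q) q (+ n)
      g n = recipPoch (W * q) q (+ n)
      h n = recipPoch (A * q) q (+ n)

      -- The summand of `gauss-sum`: everything that depends on r (with X = Z) or on s (with X = W)
      -- once t is fixed.
      Y : ℕ → Carrier → (ℕ → Carrier) → ℕ → ℕ → Carrier
      Y n X e r t = rq⊖ n r * (pow X r * pow q (r ℕ.* (r ℕ.∸ t)) * rq⊖ r t * e r)

    poch*h : ∀ n → poch (A * q) q n * h n ≈ 1#
    poch*h n = ⁻¹-inverse _ (poch-nonzero ZW-nonroot n)

    -- The expansion naturally stops at t = r. Padding it with zeros up to n makes the range of t
    -- independent of r, so that the t-sum can be moved outside.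
    Phi₀-expand : ∀ {n} r s → r ℕ.≤ n →
      Phi₀ r s Z W ≈ sumUpTo n (λ t → qPair r s t * rq t * h t) * (f r * g s)
    Phi₀-expand {n} r s r≤n = begin
      poch (A * q) q (r ℕ.+ s) * rq r * f r * h r * rq s * g s * h s
        ≈⟨ *-congʳ (*-congʳ (*-congʳ (*-congʳ (*-congʳ (*-congʳ (poch-+ (A * q) q r s)))))) ⟩
      poch (A * q) q r * poch (A * q * pow q r) q s * rq r * f r * h r * rq s * g s * h s
        ≈⟨ solve 8 (λ p p′ x f h y g h′ → p :* p′ :* x :* f :* h :* y :* g :* h′
             := p :* h :* (x :* y :* p′ :* h′ :* (f :* g))) refl _ _ _ _ _ _ _ _ ⟩
      poch (A * q) q r * h r * (rq r * rq s * poch (A * q * pow q r) q s * h s * (f r * g s))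
        ≈⟨ trans (*-congʳ (poch*h r)) (*-identityˡ _) ⟩
      rq r * rq s * poch (A * q * pow q r) q s * h s * (f r * g s)
        ≈⟨ *-congʳ (vandermonde′ r s A h (recipPoch-suc ZW-nonroot)) ⟨
      sumUpTo r (λ t → qPair r s t * rq t * h t) * (f r * g s)
        ≈⟨ *-congʳ (sum-truncate (n ℕ.∸ r) r _ (λ t r<t → trans (*-congʳ (*-congʳ (qPair-zero s r<t)))
             (solve 2 (λ x y → con (+ 0) :* x :* y := con (+ 0)) refl _ _))) ⟨
      sumUpTo (r ℕ.+ (n ℕ.∸ r)) (λ t → qPair r s t * rq t * h t) * (f r * g s)
        ≡⟨ ≡.cong (λ k → sumUpTo k (λ t → qPair r s t * rq t * h t) * (f r * g s)) (ℕ.m+[n∸m]≡n r≤n) ⟩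
      sumUpTo n (λ t → qPair r s t * rq t * h t) * (f r * g s) ∎

    bailey₀ : ∀ n m →
      sumUpTo n (λ r → sumUpTo m (λ s → K₀ n m r s Z W * Phi₀ r s Z W)) ≈ Phi₀ n m Z W
    bailey₀ n m = begin
      sumUpTo n (λ r → sumUpTo m (λ s → K₀ n m r s Z W * Phi₀ r s Z W))
        ≈⟨ sum-cong n (λ r r≤n → sum-cong m (λ s _ → expand r s r≤n)) ⟩
      sumUpTo n (λ r → sumUpTo m (λ s → sumUpTo n (λ t → c t * (Y n Z f r t * Y m W g s t))))
        ≈⟨ sum-cong n (λ r _ → sum-swap m n _) ⟩
      sumUpTo n (λ r → sumUpTo n (λ t → sumUpTo m (λ s → c t * (Y n Z f r t * Y m W g s t))))
        ≈⟨ sum-swap n n _ ⟩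
      sumUpTo n (λ t → sumUpTo n (λ r → sumUpTo m (λ s → c t * (Y n Z f r t * Y m W g s t))))
        ≈⟨ sum-cong n (λ t _ → factor t) ⟩
      sumUpTo n (λ t → f n * g m * (rq⊖ n t * rq t * (pow A t * pow q (t ℕ.* t) * rq⊖ m t * h t)))
        ≈⟨ sum-*ˡ n _ _ ⟨
      f n * g m * sumUpTo n (λ t → rq⊖ n t * rq t * (pow A t * pow q (t ℕ.* t) * rq⊖ m t * h t))
        -- Here the terminating case is used: d is t ↦ 1/(q;q)_(m-t) and x = q^m.
        ≈⟨ *-congˡ (vandermonde n (pow q m) A (rq⊖ m) h (rq⊖-suc m) (recipPoch-suc ZW-nonroot)) ⟩
      f n * g m * (rq n * poch (A * pow q m * q) q n * h n * rq m)
        ≈⟨ *-identityˡ _ ⟨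
      1# * (f n * g m * (rq n * poch (A * pow q m * q) q n * h n * rq m))
        -- Inserting 1 = (Aq;q)_m/(Aq;q)_m completes (Aq^(m+1);q)_n to (Aq;q)_(m+n) and supplies the
        -- missing reciprocal of (Aq;q)_m.
        ≈⟨ *-cong (sym (poch*h m)) (*-congˡ (*-congʳ (*-congʳ (*-congˡ
             (poch-cong q n (solve 3 (λ A x q → A :* x :* q := A :* q :* x) refl A _ q)))))) ⟩
      poch (A * q) q m * h m * (f n * g m * (rq n * poch (A * q * pow q m) q n * h n * rq m))
        ≈⟨ solve 8 (λ p h′ f g x p′ h y → p :* h′ :* (f :* g :* (x :* p′ :* h :* y))
             := p :* p′ :* x :* f :* h :* y :* g :* h′) refl _ _ _ _ _ _ _ _ ⟩
      poch (A * q) q m * poch (A * q * pow q m) q n * rq n * f n * h n * rq m * g m * h m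
        ≈⟨ *-congʳ (*-congʳ (*-congʳ (*-congʳ (*-congʳ (*-congʳ (poch-+ (A * q) q m n)))))) ⟨
      poch (A * q) q (m ℕ.+ n) * rq n * f n * h n * rq m * g m * h m
        ≡⟨ ≡.cong (λ k → poch (A * q) q k * rq n * f n * h n * rq m * g m * h m) (ℕ.+-comm m n) ⟩
      Phi₀ n m Z W ∎
      where
      c : ℕ → Carrier
      c t = pow q (t ℕ.* t) * rq t * h t

      expand : ∀ r s → r ℕ.≤ n →
        K₀ n m r s Z W * Phi₀ r s Z W ≈ sumUpTo n (λ t → c t * (Y n Z f r t * Y m W g s t))
      expand r s r≤n = begin
        K₀ n m r s Z W * Phi₀ r s Z W
          ≈⟨ *-congˡ (Phi₀-expand r s r≤n) ⟩
        K₀ n m r s Z W * (sumUpTo n (λ t → qPair r s t * rq t * h t) * (f r * g s))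
          ≈⟨ solve 3 (λ x y z → x :* (y :* z) := x :* z :* y) refl _ _ _ ⟩
        K₀ n m r s Z W * (f r * g s) * sumUpTo n (λ t → qPair r s t * rq t * h t)
          ≈⟨ sum-*ˡ n _ _ ⟩
        sumUpTo n (λ t → K₀ n m r s Z W * (f r * g s) * (qPair r s t * rq t * h t))
          ≈⟨ sum-cong n (λ t _ → regroup t) ⟩
        sumUpTo n (λ t → c t * (Y n Z f r t * Y m W g s t)) ∎
        where
        regroup : ∀ t → K₀ n m r s Z W * (f r * g s) * (qPair r s t * rq t * h t)
          ≈ c t * (Y n Z f r t * Y m W g s t)
        regroup t = begin
          pow Z r * pow W s * zpow q (quad r s) * rq⊖ n r * rq⊖ m s * (f r * g s) * (qPair r s t * rq t * h t)
            ≈⟨ solve 10 (λ z w e n m f g p x h → z :* w :* e :* n :* m :* (f :* g) :* (p :* x :* h)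
                 := e :* p :* (z :* w :* n :* m :* f :* g :* x :* h))
                 refl (pow Z r) (pow W s) _ _ _ _ _ (qPair r s t) _ _ ⟩
          zpow q (quad r s) * qPair r s t * (pow Z r * pow W s * rq⊖ n r * rq⊖ m s * f r * g s * rq t * h t)
            ≈⟨ *-congʳ (quad-qPair r s t) ⟩
          pow q (t ℕ.* t) * (pow q (r ℕ.* (r ℕ.∸ t)) * rq⊖ r t) * (pow q (s ℕ.* (s ℕ.∸ t)) * rq⊖ s t)
            * (pow Z r * pow W s * rq⊖ n r * rq⊖ m s * f r * g s * rq t * h t)
            ≈⟨ solve 13 (λ T a b c d z w n m f g x h →
                 T :* (a :* b) :* (c :* d) :* (z :* w :* n :* m :* f :* g :* x :* h)
                   := T :* x :* h :* (n :* (z :* a :* b :* f) :* (m :* (w :* c :* d :* g))))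
                 refl _ _ _ _ _ _ _ _ _ _ _ _ _ ⟩
          c t * (Y n Z f r t * Y m W g s t) ∎

      factor : ∀ t →
        sumUpTo n (λ r → sumUpTo m (λ s → c t * (Y n Z f r t * Y m W g s t)))
          ≈ f n * g m * (rq⊖ n t * rq t * (pow A t * pow q (t ℕ.* t) * rq⊖ m t * h t))
      factor t = begin
        sumUpTo n (λ r → sumUpTo m (λ s → c t * (Y n Z f r t * Y m W g s t)))
          ≈⟨ sum-cong n (λ r _ → trans (sym (sum-*ˡ m _ _)) (*-congˡ (sym (sum-*ˡ m _ _)))) ⟩
        sumUpTo n (λ r → c t * (Y n Z f r t * sumUpTo m (λ s → Y m W g s t)))
          ≈⟨ trans (sym (sum-*ˡ n _ _)) (*-congˡ (sym (sum-*ʳ n _ _))) ⟩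
        c t * (sumUpTo n (λ r → Y n Z f r t) * sumUpTo m (λ s → Y m W g s t))
          ≈⟨ *-congˡ (*-cong (gauss-sum n t Z f (recipPoch-suc Z-nonroot))
                             (gauss-sum m t W g (recipPoch-suc W-nonroot))) ⟩
        c t * (pow Z t * rq⊖ n t * f n * (pow W t * rq⊖ m t * g m))
          ≈⟨ solve 9 (λ T x h z n f w m g → T :* x :* h :* (z :* n :* f :* (w :* m :* g))
               := f :* g :* (n :* x :* (z :* w :* T :* m :* h))) refl _ _ _ _ _ _ _ _ _ ⟩
        f n * g m * (rq⊖ n t * rq t * (pow Z t * pow W t * pow q (t ℕ.* t) * rq⊖ m t * h t))
          ≈⟨ *-congˡ (*-congˡ (*-congʳ (*-congʳ (*-congʳ (pow-* Z W t))))) ⟨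
        f n * g m * (rq⊖ n t * rq t * (pow A t * pow q (t ℕ.* t) * rq⊖ m t * h t)) ∎

-- Reduction of general y to y = 0

module LatticeShift {a ℓ} (F : Field a ℓ) (q : Field.Carrier F)
  (q-nonroot : ∀ k → ¬ Field._≈_ F (Field._-_ F (Field.1# F) (QCalculus.pow F q (suc k))) (Field.0# F))
  (q≉0 : ¬ Field._≈_ F q (Field.0# F))
  where
  open Field F hiding (zero)
  open QCalculus F
  open IntegerCoefficients commutativeRing
  open FieldLemmas F
  open QSums F q q-nonroot
  open BaileyKernel F q q-nonroot q≉0
  open SetoidReasoning setoid

  1⁻¹≈1 : 1# ⁻¹ ≈ 1#
  1⁻¹≈1 = sym (⁻¹-unique (λ 1≈0 → 0≉1 (sym 1≈0)) (*-identityʳ 1#))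

  pow-zpow : ∀ k n → pow (zpow q k) n ≈ zpow q (k ℤ.* + n)
  pow-zpow k zero    = reflexive (≡.cong (zpow q) (≡.sym (ℤ.*-zeroʳ k)))
  pow-zpow k (suc n) = begin
    zpow q k * pow (zpow q k) n        ≈⟨ *-congˡ (pow-zpow k n) ⟩
    zpow q k * zpow q (k ℤ.* + n)      ≈⟨ zpow-+ q≉0 k (k ℤ.* + n) ⟨
    zpow q (k ℤ.+ k ℤ.* + n)           ≡⟨ ≡.cong (zpow q) (ℤ.*-suc k (+ n)) ⟨
    zpow q (k ℤ.* + suc n)             ∎

  -- Quantifying over ℤ makes the condition stable under x → xq^l for negative l as well.
  Nonroot : Carrier → Set _
  Nonroot x = ∀ k → ¬ 1# - x * zpow q k ≈ 0#

  nonroot-ℕ : ∀ {x} → Nonroot x → ∀ k → ¬ 1# - x * pow q k ≈ 0#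
  nonroot-ℕ x-nonroot k = x-nonroot (+ k)

  nonroot-cong : ∀ {x y} → x ≈ y → Nonroot x → Nonroot y
  nonroot-cong x≈y x-nonroot k e =
    x-nonroot k (trans (+-congˡ (-‿cong (*-congʳ x≈y))) e)

  nonroot-shift : ∀ {x} l → Nonroot x → Nonroot (x * zpow q l)
  nonroot-shift {x} l x-nonroot k e = x-nonroot (l ℤ.+ k)
    (trans (+-congˡ (-‿cong (trans (*-congˡ (zpow-+ q≉0 l k)) (sym (*-assoc x _ _))))) e)

  recipPoch-cong : ∀ {x y} → x ≈ y → Nonroot x → ∀ n → recipPoch x q (+ n) ≈ recipPoch y q (+ n)
  recipPoch-cong x≈y x-nonroot n =
    ⁻¹-unique (poch-nonzero (nonroot-ℕ (nonroot-cong x≈y x-nonroot)) n)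
      (trans (*-congʳ (poch-cong q n (sym x≈y))) (⁻¹-inverse _ (poch-nonzero (nonroot-ℕ x-nonroot) n)))

  recipPoch-ℤsuc : ∀ {x} → Nonroot x → ∀ k →
    recipPoch x q k ≈ recipPoch x q (ℤ.suc k) * (1# - x * zpow q k)
  recipPoch-ℤsuc x-nonroot (+ n)           = recipPoch-suc (nonroot-ℕ x-nonroot) n
  -- Crossing from index -1 to 0 meets the reciprocal of the empty product, which is literally
  -- `1# ⁻¹`.
  recipPoch-ℤsuc x-nonroot -[1+ zero ]     = *-congʳ (sym 1⁻¹≈1)
  recipPoch-ℤsuc x-nonroot -[1+ suc n ]    = refl

  -- The rule (x;q)_(k+n) = (x;q)_k (xq^k;q)_n for an integer k. One recurrence governs all integer
  -- indices, so induction on n suffices without distinguishing the signs of k and k + n.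
  recipPoch-+ : ∀ {x} → Nonroot x → ∀ k n →
    recipPoch x q (k ℤ.+ + n) ≈ recipPoch x q k * recipPoch (x * zpow q k) q (+ n)
  recipPoch-+ {x} x-nonroot k zero = begin
    recipPoch x q (k ℤ.+ + 0)    ≡⟨ ≡.cong (recipPoch x q) (ℤ.+-identityʳ k) ⟩
    recipPoch x q k              ≈⟨ *-identityʳ _ ⟨
    recipPoch x q k * 1#         ≈⟨ *-congˡ 1⁻¹≈1 ⟨
    recipPoch x q k * 1# ⁻¹      ∎
  recipPoch-+ {x} x-nonroot k (suc n) = *-cancelˡ-nonzero (x-nonroot (k ℤ.+ + n)) (begin
    φ * recipPoch x q (k ℤ.+ + suc n)
      ≡⟨ ≡.cong (λ i → φ * recipPoch x q i) (move k (+ n)) ⟩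
    φ * recipPoch x q (ℤ.suc (k ℤ.+ + n))
      ≈⟨ *-comm _ _ ⟩
    recipPoch x q (ℤ.suc (k ℤ.+ + n)) * φ
      ≈⟨ recipPoch-ℤsuc x-nonroot (k ℤ.+ + n) ⟨
    recipPoch x q (k ℤ.+ + n)
      ≈⟨ recipPoch-+ x-nonroot k n ⟩
    recipPoch x q k * recipPoch (x * zpow q k) q (+ n)
      ≈⟨ *-congˡ (recipPoch-suc (nonroot-ℕ (nonroot-shift k x-nonroot)) n) ⟩
    recipPoch x q k * (recipPoch (x * zpow q k) q (+ suc n) * (1# - x * zpow q k * pow q n))
      ≈⟨ *-congˡ (*-congˡ (+-congˡ (-‿cong (trans (*-congˡ (zpow-+ q≉0 k (+ n))) (sym (*-assoc x _ _)))))) ⟨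
    recipPoch x q k * (recipPoch (x * zpow q k) q (+ suc n) * φ)
      ≈⟨ solve 3 (λ x y z → x :* (y :* z) := z :* (x :* y)) refl _ _ φ ⟩
    φ * (recipPoch x q k * recipPoch (x * zpow q k) q (+ suc n)) ∎)
    where
    φ = 1# - x * zpow q (k ℤ.+ + n)

    move : ∀ k n → k ℤ.+ (+ 1 ℤ.+ n) ≡ + 1 ℤ.+ (k ℤ.+ n)
    move = ℤ-Solver.solve-∀

  -- For t > n the product defining the reciprocal contains 1 - q q⁻¹ = 0.
  recipPoch-rq⊖ : ∀ n t → recipPoch q q (+ n ℤ.- + t) ≈ rq⊖ n t
  recipPoch-rq⊖ n zero = reflexive (≡.cong (recipPoch q q) (ℤ.+-identityʳ (+ n)))
  recipPoch-rq⊖ zero (suc t) = vanish t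
    where
    vanish : ∀ t → recipPoch q q -[1+ t ] ≈ 0#
    vanish zero = begin
      1# * (1# - q * (q ⁻¹ * 1#))   ≈⟨ solve 2 (λ x y → :1 :* (:1 :- x :* (y :* :1)) := :1 :- x :* y) refl q (q ⁻¹) ⟩
      1# - q * q ⁻¹                 ≈⟨ +-congˡ (-‿cong (⁻¹-inverse q q≉0)) ⟩
      1# - 1#                       ≈⟨ -‿inverseʳ 1# ⟩
      0#                            ∎
    vanish (suc t) = trans (*-congʳ (vanish t)) (zeroˡ _)
  recipPoch-rq⊖ (suc n) (suc t) = begin
    recipPoch q q (suc n ℤ.⊖ suc t)   ≡⟨ ≡.cong (recipPoch q q) (ℤ.[1+m]⊖[1+n]≡m⊖n n t) ⟩
    recipPoch q q (n ℤ.⊖ t)           ≡⟨ ≡.cong (recipPoch q q) (ℤ.m-n≡m⊖n n t) ⟨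
    recipPoch q q (+ n ℤ.- + t)       ≈⟨ recipPoch-rq⊖ n t ⟩
    rq⊖ n t                           ∎

  module _ (Z W : Carrier)
    (Z-nonroot : Nonroot (Z * q)) (W-nonroot : Nonroot (W * q)) (ZW-nonroot : Nonroot (Z * W * q))
    (a b : ℕ)
    where

    private
      y₁ y₂ y₃ k₁ k₂ : ℤ
      y₁ = + a
      y₂ = + b ℤ.- + a
      y₃ = ℤ.- + b
      -- These are y₁ - y₂ and y₂ - y₃; their sum is a + b = y₁ - y₃.
      k₁ = + a ℤ.+ + a ℤ.- + b
      k₂ = + b ℤ.+ + b ℤ.- + a

      Z′ W′ : Carrier
      Z′ = Z * zpow q k₁
      W′ = W * zpow q k₂

      Z′q : Z * q * zpow q k₁ ≈ Z′ * q
      Z′q = solve 3 (λ x y z → x :* y :* z := x :* z :* y) refl _ _ _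

      W′q : W * q * zpow q k₂ ≈ W′ * q
      W′q = solve 3 (λ x y z → x :* y :* z := x :* z :* y) refl _ _ _

      Z′W′q : Z * W * q * pow q (a ℕ.+ b) ≈ Z′ * W′ * q
      Z′W′q = begin
        Z * W * q * zpow q (+ a ℤ.+ + b)        ≡⟨ ≡.cong (λ k → Z * W * q * zpow q k) (k₁+k₂ (+ a) (+ b)) ⟩
        Z * W * q * zpow q (k₁ ℤ.+ k₂)          ≈⟨ *-congˡ (zpow-+ q≉0 k₁ k₂) ⟩
        Z * W * q * (zpow q k₁ * zpow q k₂)
          ≈⟨ solve 5 (λ z w q x y → z :* w :* q :* (x :* y) := z :* x :* (w :* y) :* q) refl _ _ _ _ _ ⟩
        Z′ * W′ * q                             ∎
        where
        k₁+k₂ : ∀ a b → a ℤ.+ b ≡ (a ℤ.+ a ℤ.- b) ℤ.+ (b ℤ.+ b ℤ.- a)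
        k₁+k₂ = ℤ-Solver.solve-∀

      Z-nonroot′ : Nonroot (Z * q * zpow q k₁)
      Z-nonroot′ = nonroot-shift k₁ Z-nonroot

      W-nonroot′ : Nonroot (W * q * zpow q k₂)
      W-nonroot′ = nonroot-shift k₂ W-nonroot

      ZW-nonroot′ : Nonroot (Z * W * q * pow q (a ℕ.+ b))
      ZW-nonroot′ = nonroot-shift (+ (a ℕ.+ b)) ZW-nonroot

      -- The value of Φ at the corner r = a, s = b of its support, with the two trivial factors
      -- 1/(q;q)_0 omitted. `D` is likewise the monomial part of the kernel at that corner.
      C : Carrier
      C = poch (Z * W * q) q (a ℕ.+ b)
        * recipPoch (Z * q) q k₁ * recipPoch (Z * W * q) q (+ (a ℕ.+ b))
        * recipPoch (W * q) q k₂ * recipPoch (Z * W * q) q (+ (a ℕ.+ b))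

      D : Carrier
      D = pow Z a * pow W b * zpow q (quad a b)

      PhiY-zeroˡ : ∀ {r} s → r ℕ.< a → PhiY r s y₁ y₂ y₃ Z W q ≈ 0#
      PhiY-zeroˡ {r} s r<a = trans
        (*-congʳ (*-congʳ (*-congʳ (*-congʳ (*-congʳ (*-congˡ
          (trans (recipPoch-rq⊖ r a) (reflexive (rq⊖-zero r<a)))))))))
        (solve 6 (λ x y z u v w → x :* con (+ 0) :* y :* z :* u :* v :* w := con (+ 0)) refl _ _ _ _ _ _)

      PhiY-zeroʳ : ∀ r {s} → s ℕ.< b → PhiY r s y₁ y₂ y₃ Z W q ≈ 0#
      PhiY-zeroʳ r {s} s<b = trans
        (*-congʳ (*-congʳ (*-congˡ
          (trans (recipPoch-rq⊖ s b) (reflexive (rq⊖-zero s<b))))))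
        (solve 6 (λ x y z u v w → x :* y :* z :* u :* con (+ 0) :* v :* w := con (+ 0)) refl _ _ _ _ _ _)

      PhiY-shift : ∀ i j → PhiY (a ℕ.+ i) (b ℕ.+ j) y₁ y₂ y₃ Z W q ≈ C * Phi₀ i j Z′ W′
      PhiY-shift i j = begin
        PhiY (a ℕ.+ i) (b ℕ.+ j) y₁ y₂ y₃ Z W q
          ≈⟨ *-cong (*-cong (*-cong (*-cong (*-cong (*-cong e₁ e₂) e₃) e₄) e₅) e₆) e₇ ⟩
        p * p′ * x * (f * f′) * (h * h₁′) * y * (g * g′) * (h * h₂′)
          ≈⟨ solve 11 (λ p p′ x f f′ h h₁ y g g′ h₂ →
               p :* p′ :* x :* (f :* f′) :* (h :* h₁) :* y :* (g :* g′) :* (h :* h₂)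
                 := p :* f :* h :* g :* h :* (p′ :* x :* f′ :* h₁ :* y :* g′ :* h₂))
               refl p p′ x f f′ h h₁′ y g g′ h₂′ ⟩
        C * Phi₀ i j Z′ W′ ∎
        where
        p   = poch (Z * W * q) q (a ℕ.+ b)
        p′  = poch (Z′ * W′ * q) q (i ℕ.+ j)
        x   = rq i
        y   = rq j
        f   = recipPoch (Z * q) q k₁
        f′  = recipPoch (Z′ * q) q (+ i)
        g   = recipPoch (W * q) q k₂
        g′  = recipPoch (W′ * q) q (+ j)
        h   = recipPoch (Z * W * q) q (+ (a ℕ.+ b))
        h₁′ = recipPoch (Z′ * W′ * q) q (+ i)
        h₂′ = recipPoch (Z′ * W′ * q) q (+ j)

        regroup : ∀ a b i j → (a ℕ.+ i) ℕ.+ (b ℕ.+ j) ≡ (a ℕ.+ b) ℕ.+ (i ℕ.+ j)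
        regroup = ℕ-Solver.solve-∀

        i₃ : ∀ a b i → (a ℤ.+ i) ℤ.- (b ℤ.- a) ≡ (a ℤ.+ a ℤ.- b) ℤ.+ i
        i₃ = ℤ-Solver.solve-∀

        i₄ : ∀ a b i → (a ℤ.+ i) ℤ.- (ℤ.- b) ≡ (a ℤ.+ b) ℤ.+ i
        i₄ = ℤ-Solver.solve-∀

        i₆ : ∀ a b j → (b ℤ.+ j) ℤ.+ (b ℤ.- a) ≡ (b ℤ.+ b ℤ.- a) ℤ.+ j
        i₆ = ℤ-Solver.solve-∀

        i₇ : ∀ a b j → (b ℤ.+ j) ℤ.+ a ≡ (a ℤ.+ b) ℤ.+ j
        i₇ = ℤ-Solver.solve-∀

        e₁ : poch (Z * W * q) q ((a ℕ.+ i) ℕ.+ (b ℕ.+ j)) ≈ p * p′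
        e₁ = trans (reflexive (≡.cong (poch (Z * W * q) q) (regroup a b i j)))
          (trans (poch-+ (Z * W * q) q (a ℕ.+ b) (i ℕ.+ j)) (*-congˡ (poch-cong q (i ℕ.+ j) Z′W′q)))

        e₂ : recipPoch q q (+ (a ℕ.+ i) ℤ.- + a) ≈ x
        e₂ = trans (recipPoch-rq⊖ (a ℕ.+ i) a) (reflexive (rq⊖-diff a i))

        e₃ : recipPoch (Z * q) q (+ (a ℕ.+ i) ℤ.- y₂) ≈ f * f′
        e₃ = trans (reflexive (≡.cong (recipPoch (Z * q) q) (i₃ (+ a) (+ b) (+ i))))
          (trans (recipPoch-+ Z-nonroot k₁ i) (*-congˡ (recipPoch-cong Z′q Z-nonroot′ i)))

        e₄ : recipPoch (Z * W * q) q (+ (a ℕ.+ i) ℤ.- y₃) ≈ h * h₁′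
        e₄ = trans (reflexive (≡.cong (recipPoch (Z * W * q) q) (i₄ (+ a) (+ b) (+ i))))
          (trans (recipPoch-+ ZW-nonroot (+ (a ℕ.+ b)) i) (*-congˡ (recipPoch-cong Z′W′q ZW-nonroot′ i)))

        e₅ : recipPoch q q (+ (b ℕ.+ j) ℤ.- + b) ≈ y
        e₅ = trans (recipPoch-rq⊖ (b ℕ.+ j) b) (reflexive (rq⊖-diff b j))

        e₆ : recipPoch (W * q) q (+ (b ℕ.+ j) ℤ.+ y₂) ≈ g * g′
        e₆ = trans (reflexive (≡.cong (recipPoch (W * q) q) (i₆ (+ a) (+ b) (+ j))))
          (trans (recipPoch-+ W-nonroot k₂ j) (*-congˡ (recipPoch-cong W′q W-nonroot′ j)))

        e₇ : recipPoch (Z * W * q) q (+ (b ℕ.+ j) ℤ.+ y₁) ≈ h * h₂′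
        e₇ = trans (reflexive (≡.cong (recipPoch (Z * W * q) q) (i₇ (+ a) (+ b) (+ j))))
          (trans (recipPoch-+ ZW-nonroot (+ (a ℕ.+ b)) j) (*-congˡ (recipPoch-cong Z′W′q ZW-nonroot′ j)))

      -- The differences n - r and m - s are unaffected by the shift; only the monomial and the
      -- quadratic exponent change, the latter by `quad-+`.
      K-shift : ∀ n m i j → K (a ℕ.+ n) (b ℕ.+ m) (a ℕ.+ i) (b ℕ.+ j) Z W q ≈ D * K₀ n m i j Z′ W′
      K-shift n m i j = begin
        K (a ℕ.+ n) (b ℕ.+ m) (a ℕ.+ i) (b ℕ.+ j) Z W q
          ≈⟨ *-cong (*-cong (*-cong (*-cong (pow-+ Z a i) (pow-+ W b j)) exponent)
               (recip a n i)) (recip b m j) ⟩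
        pow Z a * pow Z i * (pow W b * pow W j)
          * (zpow q (quad a b) * (pow (zpow q k₁) i * pow (zpow q k₂) j * zpow q (quad i j)))
          * rq⊖ n i * rq⊖ m j
          ≈⟨ solve 10 (λ A α B β E s t e n m →
               A :* α :* (B :* β) :* (E :* (s :* t :* e)) :* n :* m
                 := A :* B :* E :* (α :* s :* (β :* t) :* e :* n :* m))
               refl _ _ _ _ _ _ _ _ _ _ ⟩
        D * (pow Z i * pow (zpow q k₁) i * (pow W j * pow (zpow q k₂) j) * zpow q (quad i j) * rq⊖ n i * rq⊖ m j)
          ≈⟨ *-congˡ (*-congʳ (*-congʳ (*-congʳ (*-cong (pow-* Z _ i) (pow-* W _ j))))) ⟨
        D * K₀ n m i j Z′ W′ ∎
        where
        recip : ∀ c n i → recipPoch q q (+ (c ℕ.+ n) ℤ.- + (c ℕ.+ i)) ≈ rq⊖ n i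
        recip c n i = trans (recipPoch-rq⊖ (c ℕ.+ n) (c ℕ.+ i)) (reflexive (rq⊖-+ c n i))

        exponent : zpow q (quad (a ℕ.+ i) (b ℕ.+ j))
          ≈ zpow q (quad a b) * (pow (zpow q k₁) i * pow (zpow q k₂) j * zpow q (quad i j))
        exponent = begin
          zpow q (quad (a ℕ.+ i) (b ℕ.+ j))
            ≡⟨ ≡.cong (zpow q) (quad-+ a b i j) ⟩
          zpow q (quad a b ℤ.+ (k₁ ℤ.* + i ℤ.+ k₂ ℤ.* + j ℤ.+ quad i j))
            ≈⟨ zpow-+ q≉0 (quad a b) _ ⟩
          zpow q (quad a b) * zpow q (k₁ ℤ.* + i ℤ.+ k₂ ℤ.* + j ℤ.+ quad i j)
            ≈⟨ *-congˡ (trans (zpow-+ q≉0 (k₁ ℤ.* + i ℤ.+ k₂ ℤ.* + j) _) (*-congʳ (zpow-+ q≉0 (k₁ ℤ.* + i) _))) ⟩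
          zpow q (quad a b) * (zpow q (k₁ ℤ.* + i) * zpow q (k₂ ℤ.* + j) * zpow q (quad i j))
            ≈⟨ *-congˡ (*-congʳ (*-cong (pow-zpow k₁ i) (pow-zpow k₂ j))) ⟨
          zpow q (quad a b) * (pow (zpow q k₁) i * pow (zpow q k₂) j * zpow q (quad i j)) ∎

    -- Φ is supported on r ≥ a and s ≥ b, so both sides vanish when n < a or m < b. Otherwise
    -- `PhiY-shift` takes `C` out of every summand and puts it back on the right, so `C` is never
    -- inverted.
    bailey : ∀ n m →
      sumUpTo n (λ r → sumUpTo m (λ s → K n m r s Z W q * PhiY r s (+ a) (+ b ℤ.- + a) (ℤ.- + b) Z W q))
        ≈ pow Z a * pow W b * zpow q (quad a b) * PhiY n m (+ a) (+ b ℤ.- + a) (ℤ.- + b) Z W q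
    bailey n m with <⊎∃+ n a | <⊎∃+ m b
    ... | inj₁ n<a | _ = trans
      (sum-zero n (λ r r≤n → sum-zero m (λ s _ →
        trans (*-congˡ (PhiY-zeroˡ s (ℕ.≤-<-trans r≤n n<a))) (zeroʳ _))))
      (sym (trans (*-congˡ (PhiY-zeroˡ m n<a)) (zeroʳ _)))
    ... | inj₂ _ | inj₁ m<b = trans
      (sum-zero n (λ r _ → sum-zero m (λ s s≤m →
        trans (*-congˡ (PhiY-zeroʳ r (ℕ.≤-<-trans s≤m m<b))) (zeroʳ _))))
      (sym (trans (*-congˡ (PhiY-zeroʳ n m<b)) (zeroʳ _)))
    ... | inj₂ (n′ , ≡.refl) | inj₂ (m′ , ≡.refl) = begin
      sumUpTo (a ℕ.+ n′) (λ r → sumUpTo (b ℕ.+ m′) (λ s → T r s))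
        ≈⟨ sum-drop a n′ _ (λ r r<a → sum-zero (b ℕ.+ m′) (λ s _ →
             trans (*-congˡ (PhiY-zeroˡ s r<a)) (zeroʳ _))) ⟩
      sumUpTo n′ (λ i → sumUpTo (b ℕ.+ m′) (λ s → T (a ℕ.+ i) s))
        ≈⟨ sum-cong n′ (λ i _ → sum-drop b m′ _ (λ s s<b →
             trans (*-congˡ (PhiY-zeroʳ (a ℕ.+ i) s<b)) (zeroʳ _))) ⟩
      sumUpTo n′ (λ i → sumUpTo m′ (λ j → T (a ℕ.+ i) (b ℕ.+ j)))
        ≈⟨ sum-cong n′ (λ i _ → sum-cong m′ (λ j _ → trans (*-cong (K-shift n′ m′ i j) (PhiY-shift i j))
             (solve 4 (λ d k c p → d :* k :* (c :* p) := d :* c :* (k :* p)) refl _ _ _ _))) ⟩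
      sumUpTo n′ (λ i → sumUpTo m′ (λ j → D * C * (K₀ n′ m′ i j Z′ W′ * Phi₀ i j Z′ W′)))
        ≈⟨ sum-cong n′ (λ i _ → sum-*ˡ m′ _ _) ⟨
      sumUpTo n′ (λ i → D * C * sumUpTo m′ (λ j → K₀ n′ m′ i j Z′ W′ * Phi₀ i j Z′ W′))
        ≈⟨ sum-*ˡ n′ _ _ ⟨
      D * C * sumUpTo n′ (λ i → sumUpTo m′ (λ j → K₀ n′ m′ i j Z′ W′ * Phi₀ i j Z′ W′))
        ≈⟨ *-congˡ (bailey₀ Z′ W′ (nonroot-ℕ (nonroot-cong Z′q Z-nonroot′))
             (nonroot-ℕ (nonroot-cong W′q W-nonroot′)) (nonroot-ℕ (nonroot-cong Z′W′q ZW-nonroot′)) n′ m′) ⟩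
      D * C * Phi₀ n′ m′ Z′ W′
        ≈⟨ *-assoc D C _ ⟩
      D * (C * Phi₀ n′ m′ Z′ W′)
        ≈⟨ *-congˡ (PhiY-shift n′ m′) ⟨
      D * PhiY (a ℕ.+ n′) (b ℕ.+ m′) y₁ y₂ y₃ Z W q ∎
      where
      T : ℕ → ℕ → Carrier
      T r s = K (a ℕ.+ n′) (b ℕ.+ m′) r s Z W q * PhiY r s y₁ y₂ y₃ Z W q

-- Assembly over the six permutations

theorem4p9 : {a ℓ : Level} (F : Field a ℓ) →
    let open Field F
        open QCalculus F
    in (u v c d z w q : Carrier) →
       ¬ (q ≈ 0#) → ¬ (u ≈ 0#) → ¬ (d ≈ 0#) → ¬ (z ≈ 0#) → ¬ (w ≈ 0#) →
       ((k : ℕ) → ¬ (1# - pow q (suc k) ≈ 0#)) →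
       ((k : ℤ) → ¬ (1# - z * zpow q k ≈ 0#)) →
       ((k : ℤ) → ¬ (1# - w * zpow q k ≈ 0#)) →
       ((k : ℤ) → ¬ (1# - z * w * zpow q k ≈ 0#)) →
       (n m : ℕ) →
       sumUpTo n (λ r → sumUpTo m (λ s →
           K n m r s (z * q ⁻¹) (w * q ⁻¹) q * Phi r s u v c d z w q))
         ≈ Phi n m (u * z) (v * w) (c * z) (d * w) z w q
theorem4p9 F u v c d z w q q≉0 u≉0 d≉0 z≉0 w≉0 q-nonroot z-nonroot w-nonroot zw-nonroot n m =
  -- In the order of `S₃`, the four numbers are σ₁ - 1, 3 - σ₃, χ(σ₃ = 1) and χ(σ₁ = 3); the sign is
  -- inferred, and `≡.refl` checks a² - ab + b² = a + b by computation.
  kernelSum-+ (term _ 0 0 0 0 ≡.refl)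
  (kernelSum-+ (term _ 0 1 0 0 ≡.refl)
  (kernelSum-+ (term _ 1 0 0 0 ≡.refl)
  (kernelSum-+ (term _ 1 2 1 0 ≡.refl)
  (kernelSum-+ (term _ 2 1 0 1 ≡.refl)
  (kernelSum-+ (term _ 2 2 1 1 ≡.refl)
  -- The unit `0#` that ends the `foldr` over `S₃`.
  (sum-zero n (λ r _ → sum-zero m (λ s _ → zeroʳ _))))))))
  where
  open Field F
  open QCalculus F
  open IntegerCoefficients commutativeRing using (solve; _:=_; _:*_)
  open FieldLemmas F
  open LatticeShift F q q-nonroot q≉0
  open SetoidReasoning setoid

  Z W : Carrier
  Z = z * q ⁻¹
  W = w * q ⁻¹

  q⁻¹*q : ∀ x → x ≈ x * q ⁻¹ * q
  q⁻¹*q x = begin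
    x                ≈⟨ *-identityʳ x ⟨
    x * 1#           ≈⟨ *-congˡ (⁻¹-inverse q q≉0) ⟨
    x * (q * q ⁻¹)   ≈⟨ solve 3 (λ x q p → x :* (q :* p) := x :* p :* q) refl _ _ _ ⟩
    x * q ⁻¹ * q     ∎

  z≈Zq : z ≈ Z * q
  z≈Zq = q⁻¹*q z

  w≈Wq : w ≈ W * q
  w≈Wq = q⁻¹*q w

  zw/q≈ZWq : z * w * (q ⁻¹ * 1#) ≈ Z * W * q
  zw/q≈ZWq = begin
    z * w * (q ⁻¹ * 1#)   ≈⟨ *-congˡ (*-identityʳ _) ⟩
    z * w * q ⁻¹          ≈⟨ *-congʳ (*-congʳ z≈Zq) ⟩
    Z * q * w * q ⁻¹      ≈⟨ solve 4 (λ x q w p → x :* q :* w :* p := x :* (w :* p) :* q) refl _ _ _ _ ⟩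
    Z * W * q             ∎

  kernelSum : (ℕ → ℕ → Carrier) → Carrier
  kernelSum f = sumUpTo n (λ r → sumUpTo m (λ s → K n m r s Z W q * f r s))

  kernelSum-+ : ∀ {f g x y} → kernelSum f ≈ x → kernelSum g ≈ y →
    kernelSum (λ r s → f r s + g r s) ≈ x + y
  kernelSum-+ {f} {g} {x} {y} f≈x g≈y = begin
    kernelSum (λ r s → f r s + g r s)
      ≈⟨ sum-cong n (λ r _ → trans (sum-cong m (λ s _ → distribˡ _ _ _)) (sum-+ m _ _)) ⟩
    sumUpTo n (λ r → sumUpTo m (λ s → K n m r s Z W q * f r s) + sumUpTo m (λ s → K n m r s Z W q * g r s))
      ≈⟨ sum-+ n _ _ ⟩
    kernelSum f + kernelSum g
      ≈⟨ +-cong f≈x g≈y ⟩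
    x + y ∎

  kernelSum-* : ∀ x f → kernelSum (λ r s → x * f r s) ≈ x * kernelSum f
  kernelSum-* x f = begin
    kernelSum (λ r s → x * f r s)
      ≈⟨ sum-cong n (λ r _ → sum-cong m (λ s _ → solve 3 (λ k x f → k :* (x :* f) := x :* (k :* f)) refl _ _ _)) ⟩
    sumUpTo n (λ r → sumUpTo m (λ s → x * (K n m r s Z W q * f r s)))
      ≈⟨ sum-cong n (λ r _ → sum-*ˡ m _ _) ⟨
    sumUpTo n (λ r → x * sumUpTo m (λ s → K n m r s Z W q * f r s))
      ≈⟨ sum-*ˡ n _ _ ⟨
    x * kernelSum f ∎

  -- Passing from (u, v, c, d) to (uz, vw, cz, dw) leaves v/d and c/u unchanged, so its whole effect
  -- on a summand is the factor z^a w^b coming from (uz)^a and (dw)^b.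
  cancel-common : ∀ x {y t} → ¬ y ≈ 0# → ¬ t ≈ 0# → (x * t) * (y * t) ⁻¹ ≈ x * y ⁻¹
  cancel-common x {y} {t} y≉0 t≉0 = begin
    (x * t) * (y * t) ⁻¹
      ≈⟨ *-congˡ (⁻¹-unique (*-nonzero y≉0 t≉0) (begin
           y * t * (y ⁻¹ * t ⁻¹)
             ≈⟨ solve 4 (λ y t y′ t′ → y :* t :* (y′ :* t′) := y :* y′ :* (t :* t′)) refl _ _ _ _ ⟩
           y * y ⁻¹ * (t * t ⁻¹)
             ≈⟨ *-cong (⁻¹-inverse y y≉0) (⁻¹-inverse t t≉0) ⟩
           1# * 1#
             ≈⟨ *-identityʳ 1# ⟩
           1# ∎)) ⟨
    (x * t) * (y ⁻¹ * t ⁻¹)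
      ≈⟨ solve 4 (λ x t y′ t′ → x :* t :* (y′ :* t′) := x :* y′ :* (t :* t′)) refl _ _ _ _ ⟩
    x * y ⁻¹ * (t * t ⁻¹)
      ≈⟨ trans (*-congˡ (⁻¹-inverse t t≉0)) (*-identityʳ _) ⟩
    x * y ⁻¹ ∎

  -- For y = σ − ρ the exponent quad a b = |y|²/2 equals y₁ − y₃ = a + b, so the
  -- factor produced by bailey is exactly z^a w^b.
  term : ∀ ς a b e g → quad a b ≡ + (a ℕ.+ b) →
    kernelSum (λ r s →
      ς * pow (u * z) a * pow (v * d ⁻¹) e * pow (c * u ⁻¹) g * pow (d * w) b
        * PhiY r s (+ a) (+ b ℤ.- + a) (ℤ.- + b) Z W q)
    ≈ ς * pow (u * z * z) a * pow (v * w * (d * w) ⁻¹) e * pow (c * z * (u * z) ⁻¹) g * pow (d * w * w) b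
        * PhiY n m (+ a) (+ b ℤ.- + a) (ℤ.- + b) Z W q
  term ς a b e g quad≡ = begin
    kernelSum (λ r s → γ * PhiY r s y₁ y₂ y₃ Z W q)
      ≈⟨ kernelSum-* γ _ ⟩
    γ * kernelSum (λ r s → PhiY r s y₁ y₂ y₃ Z W q)
      ≈⟨ *-congˡ (bailey Z W (nonroot-cong z≈Zq z-nonroot) (nonroot-cong w≈Wq w-nonroot)
           -- Since Z = z/q and W = w/q, the base ZWq is zw/q: one step below the base of the
           -- hypothesis, hence the shift by -1.
           (nonroot-cong zw/q≈ZWq (nonroot-shift -[1+ 0 ] zw-nonroot)) a b n m) ⟩
    γ * (pow Z a * pow W b * zpow q (quad a b) * P)
      ≈⟨ *-congˡ (*-congʳ power) ⟩
    γ * (pow z a * pow w b * P)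
      ≈⟨ solve 8 (λ ς x v c y z w p → ς :* x :* v :* c :* y :* (z :* w :* p) := ς :* (x :* z) :* v :* c :* (y :* w) :* p)
           refl ς _ _ _ _ _ _ P ⟩
    ς * (pow (u * z) a * pow z a) * pow (v * d ⁻¹) e * pow (c * u ⁻¹) g * (pow (d * w) b * pow w b) * P
      ≈⟨ *-congʳ (*-cong (*-cong (*-cong (*-congˡ (pow-* (u * z) z a))
           (pow-cong e (cancel-common v d≉0 w≉0))) (pow-cong g (cancel-common c u≉0 z≉0))) (pow-* (d * w) w b)) ⟨
    ς * pow (u * z * z) a * pow (v * w * (d * w) ⁻¹) e * pow (c * z * (u * z) ⁻¹) g * pow (d * w * w) b * P ∎
    where
    y₁ = + a
    y₂ = + b ℤ.- + a
    y₃ = ℤ.- + b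
    γ = ς * pow (u * z) a * pow (v * d ⁻¹) e * pow (c * u ⁻¹) g * pow (d * w) b
    P = PhiY n m y₁ y₂ y₃ Z W q

    power : pow Z a * pow W b * zpow q (quad a b) ≈ pow z a * pow w b
    power = begin
      pow Z a * pow W b * zpow q (quad a b)
        ≡⟨ ≡.cong (λ k → pow Z a * pow W b * zpow q k) quad≡ ⟩
      pow Z a * pow W b * pow q (a ℕ.+ b)
        ≈⟨ *-congˡ (pow-+ q a b) ⟩
      pow Z a * pow W b * (pow q a * pow q b)
        ≈⟨ solve 4 (λ x y s t → x :* y :* (s :* t) := x :* s :* (y :* t)) refl _ _ _ _ ⟩
      pow Z a * pow q a * (pow W b * pow q b)
        ≈⟨ *-cong (pow-* Z q a) (pow-* W q b) ⟨
      pow (Z * q) a * pow (W * q) b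
        ≈⟨ *-cong (pow-cong a z≈Zq) (pow-cong b w≈Wq) ⟨
      pow z a * pow w b ∎
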